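{- There are absolute constants $C>0$ and $\alpha>0$ such that the following holds. Let $n, N, c$ be positive integers with $N \ge 10n$, let $f:\mathbb{F}_2^n \to \{0,1\}$, and let $F:(\mathbb{F}_2^n)^N \to \{0,1\}$ be defined by $F(x_1,\ldots,x_N) = f(x_1+\cdots+x_N)$. Suppose that $F$ has a one-way broadcasting protocol with $c$ bits of communication per message and success probability $q$. Then there exists a linear sketch of cost $k$ which computes $f$ with success probability at least $q - 2^{ -\alpha N}$, where $k \le C c$ (i.e. $k = O(c)$).
   Context: One-way broadcasting protocol: there are $N$ players, player $i$ holding input $x_i\in\mathbb{F}_2^n$, and the players share a random string $\mathbf{r}\in\{0,1\}^{r}$. The players speak in order $1,\ldots,N$; player $i$ sends the message $\mathbf{m}_i = M_i(x_i,\mathbf{m}_1,\ldots,\mathbf{m}_{i-1},\mathbf{r})$, where for $1\le i\le N-1$ the message $\mathbf{m}_i\in\{0,1\}^c$ (this is "$c$ bits of communication per message"), and the last message $\mathbf{m}_N\in\{0,1\}$ is the output of the protocol, written $G(x_1,\ldots,x_N,\mathbf{r})$. The protocol computes $F$ with success probability $q$ if for all inputs $x_1,\ldots,x_N\in\mathbb{F}_2^n$, $\Pr_{\mathbf{r}}[G(x_1,\ldots,x_N,\mathbf{r}) = F(x_1,\ldots,x_N)]\ge q$. A function $g:\mathbb{F}_2^n\to\{0,1\}$ is a $k$-linear-junta if $g(x)=h(\ell_1(x),\ldots,\ell_k(x))$ for some linear functions $\ell_1,\ldots,\ell_k:\mathbb{F}_2^n\to\mathbb{F}_2$ and an arbitrary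 $h:\mathbb{F}_2^k\to\{0,1\}$. A linear sketch of cost $k$ is a probability distribution $\mathbf{g}$ over $k$-linear-juntas; it computes $f$ with success probability $q'$ if for every $x\in\mathbb{F}_2^n$, $\Pr[\mathbf{g}(x)=f(x)]\ge q'$. -}

module Defs where

open import Data.Bool using (Bool; true; false; _xor_; _∧_; if_then_else_)
open import Data.Nat as ℕ using (ℕ; zero; suc; _<_; s≤s)
open import Data.Nat.Properties using (m^n≢0; m<n⇒m<1+n)
open import Data.Integer using (+_)
open import Data.Rational using (ℚ; _/_; _*_; _-_; _≤_; 1ℚ)
open import Data.Fin using (Fin; fromℕ<; fromℕ)
open import Data.Vec using (Vec; []; _∷_; _∷ʳ_; lookup; map; foldr; zipWith; replicate)
open import Data.List as List using (List; length; filter; concatMap)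
open import Data.Sum using (_⊎_)
open import Relation.Binary.PropositionalEquality using (_≡_)

𝔽₂^ : ℕ → Set
𝔽₂^ n = Vec Bool n

_⊕_ : ∀ {n} → 𝔽₂^ n → 𝔽₂^ n → 𝔽₂^ n
_⊕_ = zipWith _xor_

𝟎 : ∀ {n} → 𝔽₂^ n
𝟎 = replicate _ false

sumVecs : ∀ {n N} → Vec (𝔽₂^ n) N → 𝔽₂^ n
sumVecs = foldr _ _⊕_ 𝟎

allVecs : (R : ℕ) → List (Vec Bool R)
allVecs zero = [] List.∷ List.[]
allVecs (suc R) = concatMap (λ v → (false ∷ v) List.∷ (true ∷ v) List.∷ List.[]) (allVecs R)

countB : ∀ {A : Set} → (A → Bool) → List A → ℕ
countB p List.[] = 0
countB p (a List.∷ as) = if p a then suc (countB p as) else countB p as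

_==_ : Bool → Bool → Bool
true == b = b
false == true = false
false == false = true

-- One-way broadcasting protocols.
-- There are N = suc m players, indexed 0,…,m (player i here = player i+1 of
-- the paper).  Players 0,…,m-1 send c-bit messages depending on their own
-- input, all previous messages and the shared random string r ∈ {0,1}^R;
-- player m (the last one) sends a single bit, the output.

record Protocol (n m c R : ℕ) : Set where
  field
    msg : (i : ℕ) → i < m → 𝔽₂^ n → Vec (Vec Bool c) i → Vec Bool R → Vec Bool c
    out : 𝔽₂^ n → Vec (Vec Bool c) m → Vec Bool R → Bool

module _ {n m c R : ℕ} (P : Protocol n m c R)
         (xs : Vec (𝔽₂^ n) (suc m)) (r : Vec Bool R) where
  open Protocol P

  transcript : (k : ℕ) → k ℕ.≤ m → Vec (Vec Bool c) k
  transcript zero _ = []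
  transcript (suc k) (s≤s k<m) =
    let prev = transcript k (m<n⇒m<1+n-≤ k<m) in
    prev ∷ʳ msg k (s≤s k<m) (lookup xs (fromℕ< (m<n⇒m<1+n (s≤s k<m)))) prev r
    where
      m<n⇒m<1+n-≤ : ∀ {a b} → a ℕ.≤ b → a ℕ.≤ suc b
      m<n⇒m<1+n-≤ = Data.Nat.Properties.m≤n⇒m≤1+n
        where import Data.Nat.Properties

  runProtocol : Bool
  runProtocol = out (lookup xs (fromℕ m)) (transcript m Data.Nat.Properties.≤-refl) r
    where import Data.Nat.Properties

protocolSuccessProb : ∀ {n m c R} → Protocol n m c R →
                      (Vec (𝔽₂^ n) (suc m) → Bool) → Vec (𝔽₂^ n) (suc m) → ℚ
protocolSuccessProb {R = R} P F xs =
  _/_ (+ countB (λ r → runProtocol P xs r == F xs) (allVecs R)) (2 ℕ.^ R) {{m^n≢0 2 R}}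

linFun : ∀ {n} → 𝔽₂^ n → 𝔽₂^ n → Bool
linFun a x = foldr _ _xor_ false (zipWith _∧_ a x)

record LinJunta (n k : ℕ) : Set where
  field
    ℓs : Vec (𝔽₂^ n) k
    h  : Vec Bool k → Bool

evalJunta : ∀ {n k} → LinJunta n k → 𝔽₂^ n → Bool
evalJunta g x = LinJunta.h g (map (λ a → linFun a x) (LinJunta.ℓs g))

-- A linear sketch of cost k: a probability distribution over k-linear-juntas,
-- given as a (nonempty) finite list of juntas with the uniform distribution on
-- list positions (multiplicities encode rational weights).
record LinSketch (n k : ℕ) : Set where
  field
    support  : List (LinJunta n k)
    nonempty : 0 ℕ.< length support

sketchSuccessProb : ∀ {n k} → LinSketch n k → (𝔽₂^ n → Bool) → 𝔽₂^ n → ℚ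
sketchSuccessProb S f x =
  _/_ (+ countB (λ g → evalJunta g x == f x) (LinSketch.support S))
      (length (LinSketch.support S)) {{ℕ.>-nonZero (LinSketch.nonempty S)}}

-- Exponential error term with α = 1/d:
-- "p ≥ q - 2^(-N/d)"  ⇔  p ≥ q  or  (q - p)^d ≤ 2^(-N)  (i.e. (q-p)^d · 2^N ≤ 1).

_^ℚ_ : ℚ → ℕ → ℚ
p ^ℚ zero = 1ℚ
p ^ℚ suc k = p * (p ^ℚ k)

AtLeastMinusExp : (p q : ℚ) (d N : ℕ) → Set
AtLeastMinusExp p q d N = (q ≤ p) ⊎ (((q - p) ^ℚ d) * (+ (2 ℕ.^ N) / 1) ≤ 1ℚ)

module Submission where

-- For a fixed random string r and transcript t, the players' inputs producing t
-- form a rectangle A₁ × … × A_m, m = N − 1.  Call a character γ heavy for t if more than about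
-- half of the Aᵢ are biased towards γ by a factor at least 1/2.  The density of
-- the rectangle is at least 2^(-2cm) except with probability 2^(-cm), and then an
-- entropy count shows that independent heavy characters number at most O(c).
-- The remaining characters have Fourier coefficient at most 2^(-m/2) on the
-- distribution of y₁ + ⋯ + y_m conditioned on t, so there are too few of them
-- (2^n ≤ 2^(N/10)) to matter: shifting this sum by a vector orthogonal to all
-- heavy characters changes its law by an exponentially small amount.
--
-- The sketch draws r and uniform y₁, …, y_m, computes the transcript t, reads the
-- heavy characters of x, picks a vector x′ with the same values, and outputs what
-- the last player would answer on input x′ + Σ yᵢ.  With x in place of x′ this is
-- an honest run on inputs summing to x, whose success probability is at least q
-- for every x, so no minimax argument is needed.

open import Defs
open import Algebra.Bundles using (CommutativeMonoid; CommutativeRing; CommutativeSemiring)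
open import Data.Bool using (Bool; true; false; _xor_; _∧_; not)
import Data.Bool.Properties as Boolₚ
open import Data.Fin as Fin using (Fin; fromℕ<; fromℕ; toℕ)
import Data.Fin.Properties as Finₚ
open import Data.Fin.Subset.Properties using (anySubset?)
open import Data.Integer as ℤ using (ℤ; +_; ∣_∣; -1ℤ; 1ℤ)
import Data.Integer.Properties as ℤₚ
import Data.Integer.Tactic.RingSolver as ℤ-Solver
open import Data.List as List using (List; []; _∷_; _++_; length; cartesianProductWith; concatMap; filter)
open import Data.List.Membership.Propositional using (_∈_)
open import Data.List.Membership.Propositional.Properties using (∈-cartesianProductWith⁺; ∈-filter⁺)
open import Data.List.Relation.Unary.All as All using (All; []; _∷_)
open import Data.List.Relation.Unary.All.Properties using (all-filter; filter⁺)
open import Data.List.Relation.Unary.Any using (here; there)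
open import Data.Nat using (ℕ; zero; suc; _+_; _*_; _≤_; _<_; _^_; z≤n; s≤s; _≤?_; _<?_; _/_; ⌊_/2⌋; NonZero; >-nonZero)
open import Data.Nat.DivMod using (m≡m%n+[m/n]*n; m%n<n; m/n*n≤m)
import Data.Nat.Properties as ℕₚ
import Data.Nat.Tactic.RingSolver as ℕ-Solver
open import Data.Product using (Σ; ∃; _×_; _,_; proj₁; proj₂)
open import Data.Rational as ℚ using (ℚ; 0ℚ; 1ℚ; toℚᵘ; ↥_; ↧_) renaming (_≤_ to _≤ℚ_)
import Data.Rational.Properties as ℚₚ
open import Data.Rational.Unnormalised as ℚᵘ using (mkℚᵘ)
import Data.Rational.Unnormalised.Properties as ℚᵘₚ
open import Data.Sum using (inj₁; inj₂)
open import Data.Vec as Vec using (Vec; []; _∷_; _∷ʳ_; lookup; truncate; tabulate)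
import Data.Vec.Properties as Vecₚ
open import Function using (_∘_)
open import Relation.Binary using (DecidableEquality)
open import Relation.Binary.PropositionalEquality
open import Relation.Nullary using (Dec; yes; no; contradiction)
open import Relation.Nullary.Decidable using (⌊_⌋; _×-dec_)
open import Relation.Unary using (Decidable)
open import Algebra.Properties.CommutativeSemigroup ℕₚ.*-commutativeSemigroup
  using () renaming (interchange to *-interchange; x∙yz≈y∙xz to *-exchange)
open import Algebra.Properties.CommutativeSemigroup (CommutativeRing.+-commutativeSemigroup Boolₚ.xor-∧-commutativeRing)
  using () renaming (interchange to xor-interchange)

-- Finite sums and products

vecs : ∀ {a} {A : Set a} → List A → (m : ℕ) → List (Vec A m)
vecs as zero = [] ∷ []
vecs as (suc m) = cartesianProductWith _∷_ as (vecs as m)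

bits : List Bool
bits = false ∷ true ∷ []

cube : (n : ℕ) → List (𝔽₂^ n)
cube = vecs bits

-- Stated over any commutative semiring because both ℕ, for counting inputs, and ℤ, for signed
-- character sums, are needed.
module Sum {c ℓ} (S : CommutativeSemiring c ℓ) where
  private
    module S = CommutativeSemiring S
    open S using (_≈_) renaming (Carrier to C)
  open import Relation.Binary.Reasoning.Setoid S.setoid
  open import Algebra.Properties.CommutativeSemigroup S.+-commutativeSemigroup using (interchange)

  ∑ : ∀ {a} {A : Set a} → List A → (A → C) → C
  ∑ [] f = S.0#
  ∑ (x ∷ xs) f = f x S.+ ∑ xs f

  ∏ : ∀ {a} {A : Set a} {m} → (A → C) → Vec A m → C
  ∏ f [] = S.1#
  ∏ f (x ∷ xs) = f x S.* ∏ f xs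

  module _ {a} {A : Set a} where

    ∑-cong : (xs : List A) {f g : A → C} → (∀ x → f x ≈ g x) → ∑ xs f ≈ ∑ xs g
    ∑-cong [] e = S.refl
    ∑-cong (x ∷ xs) e = S.+-cong (e x) (∑-cong xs e)

    ∑-0 : (xs : List A) → ∑ xs (λ _ → S.0#) ≈ S.0#
    ∑-0 [] = S.refl
    ∑-0 (x ∷ xs) = S.trans (S.+-identityˡ _) (∑-0 xs)

    ∑-+ : (xs : List A) (f g : A → C) → ∑ xs (λ x → f x S.+ g x) ≈ ∑ xs f S.+ ∑ xs g
    ∑-+ [] f g = S.sym (S.+-identityˡ _)
    ∑-+ (x ∷ xs) f g = S.trans (S.+-congˡ (∑-+ xs f g)) (interchange _ _ _ _)

    ∑-*ˡ : (xs : List A) (k : C) (f : A → C) → ∑ xs (λ x → k S.* f x) ≈ k S.* ∑ xs f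
    ∑-*ˡ [] k f = S.sym (S.zeroʳ k)
    ∑-*ˡ (x ∷ xs) k f = S.trans (S.+-congˡ (∑-*ˡ xs k f)) (S.sym (S.distribˡ _ _ _))

    ∑-*ʳ : (xs : List A) (k : C) (f : A → C) → ∑ xs (λ x → f x S.* k) ≈ ∑ xs f S.* k
    ∑-*ʳ xs k f = S.trans (∑-cong xs (λ x → S.*-comm (f x) k)) (S.trans (∑-*ˡ xs k f) (S.*-comm k _))

    ∑-++ : (xs ys : List A) (f : A → C) → ∑ (xs ++ ys) f ≈ ∑ xs f S.+ ∑ ys f
    ∑-++ [] ys f = S.sym (S.+-identityˡ _)
    ∑-++ (x ∷ xs) ys f = S.trans (S.+-congˡ (∑-++ xs ys f)) (S.sym (S.+-assoc _ _ _))

  ∑-map : ∀ {a b} {A : Set a} {B : Set b} (h : A → B) (xs : List A) (f : B → C) →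
          ∑ (List.map h xs) f ≈ ∑ xs (f ∘ h)
  ∑-map h [] f = S.refl
  ∑-map h (x ∷ xs) f = S.+-congˡ (∑-map h xs f)

  ∑-comm : ∀ {a b} {A : Set a} {B : Set b} (xs : List A) (ys : List B) (f : A → B → C) →
           ∑ xs (λ x → ∑ ys (f x)) ≈ ∑ ys (λ y → ∑ xs (λ x → f x y))
  ∑-comm [] ys f = S.sym (∑-0 ys)
  ∑-comm (x ∷ xs) ys f = S.trans (S.+-congˡ (∑-comm xs ys f)) (S.sym (∑-+ ys _ _))

  ∑-cartesian : ∀ {a b d} {A : Set a} {B : Set b} {D : Set d} (h : A → B → D)
                (xs : List A) (ys : List B) (f : D → C) →
                ∑ (cartesianProductWith h xs ys) f ≈ ∑ xs (λ x → ∑ ys (λ y → f (h x y)))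
  ∑-cartesian h [] ys f = S.refl
  ∑-cartesian h (x ∷ xs) ys f =
    S.trans (∑-++ (List.map (h x) ys) _ f) (S.+-cong (∑-map (h x) ys f) (∑-cartesian h xs ys f))

  ∑-vecs-suc : ∀ {a} {A : Set a} (xs : List A) (m : ℕ) (f : Vec A (suc m) → C) →
               ∑ (vecs xs (suc m)) f ≈ ∑ xs (λ x → ∑ (vecs xs m) (λ y → f (x ∷ y)))
  ∑-vecs-suc xs m f = ∑-cartesian Vec._∷_ xs (vecs xs m) f

  -- Distributivity, one coordinate at a time. This is how the independence of the players' inputs
  -- enters: sizes and Fourier coefficients of a rectangle both factor over its sides.
  ∏∑ : ∀ {a b} {A : Set a} {B : Set b} {m} (xs : List A) (w : B → A → C) (bs : Vec B m) →
       ∑ (vecs xs m) (λ y → ∏ (λ p → p) (Vec.zipWith w bs y)) ≈ ∏ (λ b → ∑ xs (w b)) bs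
  ∏∑ xs w [] = S.+-identityʳ _
  ∏∑ {m = suc m} xs w (b ∷ bs) = begin
    ∑ (vecs xs (suc m)) (λ y → ∏ (λ p → p) (Vec.zipWith w (b ∷ bs) y))
      ≈⟨ ∑-vecs-suc xs m _ ⟩
    ∑ xs (λ x → ∑ (vecs xs m) (λ y → w b x S.* ∏ (λ p → p) (Vec.zipWith w bs y)))
      ≈⟨ ∑-cong xs (λ x → ∑-*ˡ (vecs xs m) (w b x) _) ⟩
    ∑ xs (λ x → w b x S.* ∑ (vecs xs m) (λ y → ∏ (λ p → p) (Vec.zipWith w bs y)))
      ≈⟨ ∑-*ʳ xs _ (w b) ⟩
    ∑ xs (w b) S.* ∑ (vecs xs m) (λ y → ∏ (λ p → p) (Vec.zipWith w bs y))
      ≈⟨ S.*-congˡ (∏∑ xs w bs) ⟩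
    ∑ xs (w b) S.* ∏ (λ b → ∑ xs (w b)) bs ∎

  -- Adding `b` to the first coordinate either fixes the two bits or swaps the two summands.
  ∑-translate : ∀ {n} (v : 𝔽₂^ n) (f : 𝔽₂^ n → C) → ∑ (cube n) (λ x → f (v ⊕ x)) ≈ ∑ (cube n) f
  ∑-translate [] f = S.refl
  ∑-translate {suc n} (b ∷ v) f = begin
    ∑ (cube (suc n)) (λ x → f ((b ∷ v) ⊕ x)) ≈⟨ ∑-vecs-suc bits n _ ⟩
    ∑ bits (λ a → ∑ (cube n) (λ x → f ((b xor a) ∷ (v ⊕ x))))
      ≈⟨ ∑-cong bits (λ a → ∑-translate v (λ x → f ((b xor a) ∷ x))) ⟩
    ∑ bits (λ a → ∑ (cube n) (λ x → f ((b xor a) ∷ x)))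
      ≈⟨ flip b (λ a → ∑ (cube n) (λ x → f (a ∷ x))) ⟩
    ∑ bits (λ a → ∑ (cube n) (λ x → f (a ∷ x))) ≈⟨ ∑-vecs-suc bits n f ⟨
    ∑ (cube (suc n)) f ∎
    where
    flip : ∀ b (g : Bool → C) → ∑ bits (λ a → g (b xor a)) ≈ ∑ bits g
    flip false g = S.refl
    flip true g = S.trans (S.+-congˡ (S.+-identityʳ _))
                    (S.trans (S.+-comm _ _) (S.+-congˡ (S.sym (S.+-identityʳ _))))

module ℕΣ = Sum ℕₚ.+-*-commutativeSemiring
module ℤΣ = Sum ℤₚ.+-*-commutativeSemiring
open ℕΣ using (∑; ∏)

𝟙 : Bool → ℕ
𝟙 true = 1
𝟙 false = 0

module _ {a} {A : Set a} where

  ∑-mono : (xs : List A) {f g : A → ℕ} → (∀ x → f x ≤ g x) → ∑ xs f ≤ ∑ xs g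
  ∑-mono [] e = z≤n
  ∑-mono (x ∷ xs) e = ℕₚ.+-mono-≤ (e x) (∑-mono xs e)

  ∑-const : (xs : List A) (k : ℕ) → ∑ xs (λ _ → k) ≡ length xs * k
  ∑-const [] k = refl
  ∑-const (x ∷ xs) k = cong (_+_ k) (∑-const xs k)

  length≡∑1 : (xs : List A) → length xs ≡ ∑ xs (λ _ → 1)
  length≡∑1 xs = trans (sym (ℕₚ.*-identityʳ _)) (sym (∑-const xs 1))

  +∑ : (xs : List A) (f : A → ℕ) → + ∑ xs f ≡ ℤΣ.∑ xs (λ x → + f x)
  +∑ [] f = refl
  +∑ (x ∷ xs) f = cong (λ z → (+ f x) ℤ.+ z) (+∑ xs f)

  ∣∑∣≤ : (xs : List A) (f : A → ℤ) → ∣ ℤΣ.∑ xs f ∣ ≤ ∑ xs (λ x → ∣ f x ∣)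
  ∣∑∣≤ [] f = z≤n
  ∣∑∣≤ (x ∷ xs) f = ℕₚ.≤-trans (ℤₚ.∣i+j∣≤∣i∣+∣j∣ (f x) _) (ℕₚ.+-monoʳ-≤ _ (∣∑∣≤ xs f))

length-vecs : ∀ {a} {A : Set a} (as : List A) m → length (vecs as m) ≡ length as ^ m
length-vecs as zero = refl
length-vecs as (suc m) = trans (length≡∑1 (vecs as (suc m)))
  (trans (ℕΣ.∑-vecs-suc as m (λ _ → 1))
  (trans (∑-const as _) (cong (length as *_) (trans (sym (length≡∑1 (vecs as m))) (length-vecs as m)))))

-- Fourier analysis on the cube

linFun-⊕ : ∀ {n} (γ x y : 𝔽₂^ n) → linFun γ (x ⊕ y) ≡ linFun γ x xor linFun γ y
linFun-⊕ [] [] [] = refl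
linFun-⊕ (g ∷ γ) (a ∷ x) (b ∷ y) =
  trans (cong₂ _xor_ (Boolₚ.∧-distribˡ-xor g a b) (linFun-⊕ γ x y))
        (xor-interchange (g ∧ a) (g ∧ b) (linFun γ x) (linFun γ y))

linFun-𝟎 : ∀ {n} (γ : 𝔽₂^ n) → linFun γ 𝟎 ≡ false
linFun-𝟎 [] = refl
linFun-𝟎 (false ∷ γ) = linFun-𝟎 γ
linFun-𝟎 (true ∷ γ) = linFun-𝟎 γ

χ : Bool → ℤ
χ false = 1ℤ
χ true = -1ℤ

χ-xor : ∀ a b → χ (a xor b) ≡ χ a ℤ.* χ b
χ-xor false b = sym (ℤₚ.*-identityˡ (χ b))
χ-xor true false = refl
χ-xor true true = refl

∣χ∣ : ∀ b → ∣ χ b ∣ ≡ 1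
∣χ∣ false = refl
∣χ∣ true = refl

-- Unnormalised, so that all coefficients are integers; the factor `2 ^ n` reappears in the
-- inversion formula.
fourier : ∀ {n} → (𝔽₂^ n → ℤ) → 𝔽₂^ n → ℤ
fourier {n} φ γ = ℤΣ.∑ (cube n) (λ w → φ w ℤ.* χ (linFun γ w))

fourier-∷ : ∀ {n} (φ : 𝔽₂^ (suc n) → ℤ) g γ →
            fourier φ (g ∷ γ) ≡ fourier (φ ∘ (false ∷_)) γ ℤ.+ χ g ℤ.* fourier (φ ∘ (true ∷_)) γ
fourier-∷ {n} φ g γ = begin
  fourier φ (g ∷ γ)
    ≡⟨ ℤΣ.∑-vecs-suc bits n (λ w → φ w ℤ.* χ (linFun (g ∷ γ) w)) ⟩
  ∑₀ (λ w → φ (false ∷ w) ℤ.* χ ((g ∧ false) xor linFun γ w))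
    ℤ.+ (∑₀ (λ w → φ (true ∷ w) ℤ.* χ ((g ∧ true) xor linFun γ w)) ℤ.+ ℤ.0ℤ)
    ≡⟨ cong₂ ℤ._+_ (ℤΣ.∑-cong (cube n) (λ w → cong (φ (false ∷ w) ℤ.*_) (first g (linFun γ w))))
                   (trans (ℤₚ.+-identityʳ _) (ℤΣ.∑-cong (cube n) (λ w → second g (φ (true ∷ w)) (linFun γ w)))) ⟩
  fourier (φ ∘ (false ∷_)) γ ℤ.+ ∑₀ (λ w → χ g ℤ.* (φ (true ∷ w) ℤ.* χ (linFun γ w)))
    ≡⟨ cong (λ z → fourier (φ ∘ (false ∷_)) γ ℤ.+ z) (ℤΣ.∑-*ˡ (cube n) (χ g) _) ⟩
  _ ∎
  where
  open ≡-Reasoning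
  ∑₀ = ℤΣ.∑ (cube n)
  first : ∀ g l → χ ((g ∧ false) xor l) ≡ χ l
  first false l = refl
  first true l = refl
  comm : ∀ p g l → p ℤ.* (g ℤ.* l) ≡ g ℤ.* (p ℤ.* l)
  comm = ℤ-Solver.solve-∀
  second : ∀ g p l → p ℤ.* χ ((g ∧ true) xor l) ≡ χ g ℤ.* (p ℤ.* χ l)
  second false p l = sym (ℤₚ.*-identityˡ _)
  second true p l = trans (cong (p ℤ.*_) (χ-xor true l)) (comm p -1ℤ (χ l))

-- Induction on `n`: of the two halves of `φ`, the one whose first bit differs from `b` cancels
-- between the frequencies `false ∷ γ` and `true ∷ γ`, and the other one is doubled.
fourier-inversion : ∀ {n} (φ : 𝔽₂^ n → ℤ) z →
  ℤΣ.∑ (cube n) (λ γ → fourier φ γ ℤ.* χ (linFun γ z)) ≡ + (2 ^ n) ℤ.* φ z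
fourier-inversion {zero} φ [] = base (φ [])
  where
  base : ∀ p → (p ℤ.* 1ℤ ℤ.+ ℤ.0ℤ) ℤ.* 1ℤ ℤ.+ ℤ.0ℤ ≡ 1ℤ ℤ.* p
  base = ℤ-Solver.solve-∀
fourier-inversion {suc n} φ (b ∷ z) = begin
  ℤΣ.∑ (cube (suc n)) (λ γ → fourier φ γ ℤ.* χ (linFun γ (b ∷ z)))
    ≡⟨ ℤΣ.∑-vecs-suc bits n (λ γ → fourier φ γ ℤ.* χ (linFun γ (b ∷ z))) ⟩
  ∑₀ (λ γ → fourier φ (false ∷ γ) ℤ.* χ (linFun γ z))
    ℤ.+ (∑₀ (λ γ → fourier φ (true ∷ γ) ℤ.* χ (b xor linFun γ z)) ℤ.+ ℤ.0ℤ)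
    ≡⟨ cong (λ s → ∑₀ (λ γ → fourier φ (false ∷ γ) ℤ.* χ (linFun γ z)) ℤ.+ s) (ℤₚ.+-identityʳ _) ⟩
  ∑₀ (λ γ → fourier φ (false ∷ γ) ℤ.* χ (linFun γ z))
    ℤ.+ ∑₀ (λ γ → fourier φ (true ∷ γ) ℤ.* χ (b xor linFun γ z))
    ≡⟨ ℤΣ.∑-+ (cube n) _ _ ⟨
  ∑₀ (λ γ → fourier φ (false ∷ γ) ℤ.* χ (linFun γ z) ℤ.+ fourier φ (true ∷ γ) ℤ.* χ (b xor linFun γ z))
    ≡⟨ ℤΣ.∑-cong (cube n) (λ γ → trans
         (cong₂ (λ s t → s ℤ.* χ (linFun γ z) ℤ.+ t ℤ.* χ (b xor linFun γ z))
                (fourier-∷ φ false γ) (fourier-∷ φ true γ))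
         (collect b γ)) ⟩
  ∑₀ (λ γ → + 2 ℤ.* (fourier (φ ∘ (b ∷_)) γ ℤ.* χ (linFun γ z)))
    ≡⟨ ℤΣ.∑-*ˡ (cube n) (+ 2) _ ⟩
  + 2 ℤ.* ∑₀ (λ γ → fourier (φ ∘ (b ∷_)) γ ℤ.* χ (linFun γ z))
    ≡⟨ cong (+ 2 ℤ.*_) (fourier-inversion (φ ∘ (b ∷_)) z) ⟩
  + 2 ℤ.* (+ (2 ^ n) ℤ.* φ (b ∷ z)) ≡⟨ ℤₚ.*-assoc (+ 2) (+ (2 ^ n)) _ ⟨
  + 2 ℤ.* + (2 ^ n) ℤ.* φ (b ∷ z) ≡⟨ cong (ℤ._* φ (b ∷ z)) (ℤₚ.pos-* 2 (2 ^ n)) ⟨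
  + (2 ^ suc n) ℤ.* φ (b ∷ z) ∎
  where
  open ≡-Reasoning
  ∑₀ = ℤΣ.∑ (cube n)
  even : ∀ f₀ f₁ c → (f₀ ℤ.+ 1ℤ ℤ.* f₁) ℤ.* c ℤ.+ (f₀ ℤ.+ -1ℤ ℤ.* f₁) ℤ.* c ≡ + 2 ℤ.* (f₀ ℤ.* c)
  even = ℤ-Solver.solve-∀
  odd : ∀ f₀ f₁ c → (f₀ ℤ.+ 1ℤ ℤ.* f₁) ℤ.* c ℤ.+ (f₀ ℤ.+ -1ℤ ℤ.* f₁) ℤ.* (-1ℤ ℤ.* c) ≡ + 2 ℤ.* (f₁ ℤ.* c)
  odd = ℤ-Solver.solve-∀
  collect : ∀ b γ →
    (fourier (φ ∘ (false ∷_)) γ ℤ.+ χ false ℤ.* fourier (φ ∘ (true ∷_)) γ) ℤ.* χ (linFun γ z)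
    ℤ.+ (fourier (φ ∘ (false ∷_)) γ ℤ.+ χ true ℤ.* fourier (φ ∘ (true ∷_)) γ) ℤ.* χ (b xor linFun γ z)
    ≡ + 2 ℤ.* (fourier (φ ∘ (b ∷_)) γ ℤ.* χ (linFun γ z))
  collect false γ = even (fourier (φ ∘ (false ∷_)) γ) (fourier (φ ∘ (true ∷_)) γ) (χ (linFun γ z))
  collect true γ = trans
    (cong (λ s → (fourier (φ ∘ (false ∷_)) γ ℤ.+ χ false ℤ.* fourier (φ ∘ (true ∷_)) γ) ℤ.* χ (linFun γ z)
                 ℤ.+ (fourier (φ ∘ (false ∷_)) γ ℤ.+ χ true ℤ.* fourier (φ ∘ (true ∷_)) γ) ℤ.* s)
          (χ-xor true (linFun γ z)))
    (odd (fourier (φ ∘ (false ∷_)) γ) (fourier (φ ∘ (true ∷_)) γ) (χ (linFun γ z)))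

-- Rectangles of inputs and their Fourier coefficients

𝟙≤1 : ∀ b → 𝟙 b ≤ 1
𝟙≤1 false = z≤n
𝟙≤1 true = s≤s z≤n

𝟙-∧ : ∀ a b → 𝟙 (a ∧ b) ≡ 𝟙 a * 𝟙 b
𝟙-∧ false b = refl
𝟙-∧ true b = sym (ℕₚ.+-identityʳ (𝟙 b))

length-cube : ∀ n → length (cube n) ≡ 2 ^ n
length-cube n = length-vecs bits n

inRect : ∀ {A : Set} {m} → Vec (A → Bool) m → Vec A m → Bool
inRect [] [] = true
inRect (A ∷ As) (x ∷ y) = A x ∧ inRect As y

size : ∀ {n} → (𝔽₂^ n → Bool) → ℕ
size {n} A = ∑ (cube n) (λ x → 𝟙 (A x))

coef : ∀ {n} → 𝔽₂^ n → (𝔽₂^ n → Bool) → ℤ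
coef γ A = fourier (λ x → + 𝟙 (A x)) γ

-- Bias at least one half, with the denominator cleared. For an empty set every character is heavy.
heavy : ∀ {n} → 𝔽₂^ n → (𝔽₂^ n → Bool) → Bool
heavy γ A = ⌊ size A ≤? 2 * ∣ coef γ A ∣ ⌋

lights : ∀ {n m} → Vec (𝔽₂^ n → Bool) m → 𝔽₂^ n → ℕ
lights As γ = ∑ (Vec.toList As) (λ A → 𝟙 (not (heavy γ A)))

∏size : ∀ {n m} (As : Vec (𝔽₂^ n → Bool) m) →
        ∑ (vecs (cube n) m) (λ y → 𝟙 (inRect As y)) ≡ ∏ size As
∏size {n} {m} As = trans (ℕΣ.∑-cong (vecs (cube n) m) (expand As)) (ℕΣ.∏∑ (cube n) (λ A x → 𝟙 (A x)) As)
  where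
  expand : ∀ {m} (As : Vec (𝔽₂^ n → Bool) m) y →
           𝟙 (inRect As y) ≡ ∏ (λ p → p) (Vec.zipWith (λ A x → 𝟙 (A x)) As y)
  expand [] [] = refl
  expand (A ∷ As) (x ∷ y) = trans (𝟙-∧ (A x) (inRect As y)) (cong (𝟙 (A x) *_) (expand As y))

∏coef : ∀ {n m} (γ : 𝔽₂^ n) (As : Vec (𝔽₂^ n → Bool) m) →
        ℤΣ.∑ (vecs (cube n) m) (λ y → + 𝟙 (inRect As y) ℤ.* χ (linFun γ (sumVecs y))) ≡ ℤΣ.∏ (coef γ) As
∏coef {n} {m} γ As =
  trans (ℤΣ.∑-cong (vecs (cube n) m) (expand As)) (ℤΣ.∏∑ (cube n) (λ A x → + 𝟙 (A x) ℤ.* χ (linFun γ x)) As)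
  where
  open ≡-Reasoning
  swap : ∀ a b c d → (a ℤ.* b) ℤ.* (c ℤ.* d) ≡ (a ℤ.* c) ℤ.* (b ℤ.* d)
  swap = ℤ-Solver.solve-∀
  expand : ∀ {m} (As : Vec (𝔽₂^ n → Bool) m) y →
           + 𝟙 (inRect As y) ℤ.* χ (linFun γ (sumVecs y))
           ≡ ℤΣ.∏ (λ p → p) (Vec.zipWith (λ A x → + 𝟙 (A x) ℤ.* χ (linFun γ x)) As y)
  expand [] [] = cong (λ b → 1ℤ ℤ.* χ b) (linFun-𝟎 γ)
  expand (A ∷ As) (x ∷ y) = begin
    + 𝟙 (A x ∧ inRect As y) ℤ.* χ (linFun γ (x ⊕ sumVecs y))
      ≡⟨ cong₂ ℤ._*_ (trans (cong +_ (𝟙-∧ (A x) (inRect As y))) (ℤₚ.pos-* (𝟙 (A x)) _))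
                     (trans (cong χ (linFun-⊕ γ x (sumVecs y))) (χ-xor (linFun γ x) _)) ⟩
    (+ 𝟙 (A x) ℤ.* + 𝟙 (inRect As y)) ℤ.* (χ (linFun γ x) ℤ.* χ (linFun γ (sumVecs y)))
      ≡⟨ swap (+ 𝟙 (A x)) _ _ _ ⟩
    (+ 𝟙 (A x) ℤ.* χ (linFun γ x)) ℤ.* (+ 𝟙 (inRect As y) ℤ.* χ (linFun γ (sumVecs y)))
      ≡⟨ cong ((+ 𝟙 (A x) ℤ.* χ (linFun γ x)) ℤ.*_) (expand As y) ⟩
    _ ∎

∣fourier∣≤ : ∀ {n} (A : 𝔽₂^ n → Bool) γ → ∣ coef γ A ∣ ≤ size A
∣fourier∣≤ {n} A γ = ℕₚ.≤-trans (∣∑∣≤ (cube n) _) (ℕₚ.≤-reflexive (ℕΣ.∑-cong (cube n) λ x →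
  trans (ℤₚ.abs-* (+ 𝟙 (A x)) (χ (linFun γ x)))
        (trans (cong (𝟙 (A x) *_) (∣χ∣ (linFun γ x))) (ℕₚ.*-identityʳ _))))

size≤ : ∀ {n} (A : 𝔽₂^ n → Bool) → size A ≤ 2 ^ n
size≤ {n} A = ℕₚ.≤-trans (∑-mono (cube n) (λ x → 𝟙≤1 (A x)))
  (ℕₚ.≤-reflexive (trans (sym (length≡∑1 (cube n))) (length-cube n)))

-- On a light side the coefficient is smaller than the size by a factor of at least 2; for the
-- remaining sides the trivial bound suffices.
lights-bound : ∀ {n m} (As : Vec (𝔽₂^ n → Bool) m) γ →
               2 ^ lights As γ * ∣ ℤΣ.∏ (coef γ) As ∣ ≤ ∏ size As
lights-bound [] γ = ℕₚ.≤-refl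
lights-bound (A ∷ As) γ = begin
  2 ^ (𝟙 (not (heavy γ A)) + lights As γ) * ∣ coef γ A ℤ.* ℤΣ.∏ (coef γ) As ∣
    ≡⟨ cong₂ _*_ (ℕₚ.^-distribˡ-+-* 2 (𝟙 (not (heavy γ A))) (lights As γ)) (ℤₚ.abs-* (coef γ A) _) ⟩
  (2 ^ 𝟙 (not (heavy γ A)) * 2 ^ lights As γ) * (∣ coef γ A ∣ * ∣ ℤΣ.∏ (coef γ) As ∣)
    ≡⟨ *-interchange (2 ^ 𝟙 (not (heavy γ A))) (2 ^ lights As γ) (∣ coef γ A ∣) _ ⟩
  (2 ^ 𝟙 (not (heavy γ A)) * ∣ coef γ A ∣) * (2 ^ lights As γ * ∣ ℤΣ.∏ (coef γ) As ∣)
    ≤⟨ ℕₚ.*-mono-≤ one (lights-bound As γ) ⟩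
  size A * ∏ size As ∎
  where
  open ℕₚ.≤-Reasoning
  one : 2 ^ 𝟙 (not (heavy γ A)) * ∣ coef γ A ∣ ≤ size A
  one with size A ≤? 2 * ∣ coef γ A ∣
  ... | yes _ = ℕₚ.≤-trans (ℕₚ.≤-reflexive (ℕₚ.+-identityʳ _)) (∣fourier∣≤ A γ)
  ... | no ¬h = ℕₚ.<⇒≤ (ℕₚ.≰⇒> ¬h)

-- For a nonempty rectangle, dividing by `∏ size As` gives the probability that `φ` holds at
-- `z ⊕ sumVecs y` for `y` uniform in the rectangle. Later `φ` is the event that the last player
-- gives a prescribed answer.
count : ∀ {n m} → Vec (𝔽₂^ n → Bool) m → (𝔽₂^ n → Bool) → 𝔽₂^ n → ℕ
count {n} {m} As φ z = ∑ (vecs (cube n) m) (λ y → 𝟙 (inRect As y) * 𝟙 (φ (z ⊕ sumVecs y)))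

-- Fourier inversion expands `φ` at `z ⊕ sumVecs y`; after exchanging the sums, multiplicativity of
-- characters turns the sum over `y` into a product over the sides.
count-fourier : ∀ {n m} (As : Vec (𝔽₂^ n → Bool) m) (φ : 𝔽₂^ n → Bool) z →
  + (2 ^ n) ℤ.* + count As φ z ≡
  ℤΣ.∑ (cube n) (λ γ → (coef γ φ ℤ.* χ (linFun γ z)) ℤ.* ℤΣ.∏ (coef γ) As)
count-fourier {n} {m} As φ z = begin
  + (2 ^ n) ℤ.* + count As φ z
    ≡⟨ cong (+ (2 ^ n) ℤ.*_) (+∑ ys _) ⟩
  + (2 ^ n) ℤ.* ℤΣ.∑ ys (λ y → + (𝟙 (inRect As y) * 𝟙 (φ (z ⊕ sumVecs y))))
    ≡⟨ ℤΣ.∑-*ˡ ys (+ (2 ^ n)) _ ⟨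
  ℤΣ.∑ ys (λ y → + (2 ^ n) ℤ.* + (𝟙 (inRect As y) * 𝟙 (φ (z ⊕ sumVecs y))))
    ≡⟨ ℤΣ.∑-cong ys pointwise ⟩
  ℤΣ.∑ ys (λ y → ℤΣ.∑ (cube n) (λ γ →
    (coef γ φ ℤ.* χ (linFun γ z)) ℤ.* (+ 𝟙 (inRect As y) ℤ.* χ (linFun γ (sumVecs y)))))
    ≡⟨ ℤΣ.∑-comm ys (cube n) _ ⟩
  ℤΣ.∑ (cube n) (λ γ → ℤΣ.∑ ys (λ y →
    (coef γ φ ℤ.* χ (linFun γ z)) ℤ.* (+ 𝟙 (inRect As y) ℤ.* χ (linFun γ (sumVecs y)))))
    ≡⟨ ℤΣ.∑-cong (cube n) (λ γ → trans (ℤΣ.∑-*ˡ ys (coef γ φ ℤ.* χ (linFun γ z)) _)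
         (cong ((coef γ φ ℤ.* χ (linFun γ z)) ℤ.*_) (∏coef γ As))) ⟩
  _ ∎
  where
  open ≡-Reasoning
  ys = vecs (cube n) m
  move : ∀ k a p → k ℤ.* (a ℤ.* p) ≡ a ℤ.* (k ℤ.* p)
  move = ℤ-Solver.solve-∀
  shuffle : ∀ a f c d → a ℤ.* (f ℤ.* (c ℤ.* d)) ≡ (f ℤ.* c) ℤ.* (a ℤ.* d)
  shuffle = ℤ-Solver.solve-∀
  pointwise : ∀ y → + (2 ^ n) ℤ.* + (𝟙 (inRect As y) * 𝟙 (φ (z ⊕ sumVecs y))) ≡
    ℤΣ.∑ (cube n) (λ γ → (coef γ φ ℤ.* χ (linFun γ z)) ℤ.* (+ 𝟙 (inRect As y) ℤ.* χ (linFun γ (sumVecs y))))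
  pointwise y = begin
    + (2 ^ n) ℤ.* + (a * 𝟙 (φ (z ⊕ sumVecs y)))
      ≡⟨ cong (+ (2 ^ n) ℤ.*_) (ℤₚ.pos-* a _) ⟩
    + (2 ^ n) ℤ.* (+ a ℤ.* + 𝟙 (φ (z ⊕ sumVecs y))) ≡⟨ move (+ (2 ^ n)) (+ a) _ ⟩
    + a ℤ.* (+ (2 ^ n) ℤ.* + 𝟙 (φ (z ⊕ sumVecs y)))
      ≡⟨ cong (+ a ℤ.*_) (fourier-inversion (λ x → + 𝟙 (φ x)) (z ⊕ sumVecs y)) ⟨
    + a ℤ.* ℤΣ.∑ (cube n) (λ γ → coef γ φ ℤ.* χ (linFun γ (z ⊕ sumVecs y)))
      ≡⟨ ℤΣ.∑-*ˡ (cube n) (+ a) _ ⟨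
    ℤΣ.∑ (cube n) (λ γ → + a ℤ.* (coef γ φ ℤ.* χ (linFun γ (z ⊕ sumVecs y))))
      ≡⟨ ℤΣ.∑-cong (cube n) (λ γ → trans
           (cong (λ s → + a ℤ.* (coef γ φ ℤ.* s))
                 (trans (cong χ (linFun-⊕ γ z (sumVecs y))) (χ-xor (linFun γ z) _)))
           (shuffle (+ a) (coef γ φ) (χ (linFun γ z)) (χ (linFun γ (sumVecs y))))) ⟩
    _ ∎
    where a = 𝟙 (inRect As y)

count-difference : ∀ {n m} (As : Vec (𝔽₂^ n → Bool) m) (φ : 𝔽₂^ n → Bool) z z′ →
  + (2 ^ n) ℤ.* (+ count As φ z ℤ.- + count As φ z′) ≡
  ℤΣ.∑ (cube n) (λ γ → (coef γ φ ℤ.* (χ (linFun γ z) ℤ.- χ (linFun γ z′))) ℤ.* ℤΣ.∏ (coef γ) As)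
count-difference {n} As φ z z′ = begin
  + (2 ^ n) ℤ.* (+ count As φ z ℤ.- + count As φ z′) ≡⟨ factor (+ (2 ^ n)) (+ count As φ z) (+ count As φ z′) ⟩
  + (2 ^ n) ℤ.* + count As φ z ℤ.+ -1ℤ ℤ.* (+ (2 ^ n) ℤ.* + count As φ z′)
    ≡⟨ cong₂ (λ s t → s ℤ.+ -1ℤ ℤ.* t) (count-fourier As φ z) (count-fourier As φ z′) ⟩
  ℤΣ.∑ (cube n) (λ γ → (coef γ φ ℤ.* χ (linFun γ z)) ℤ.* ℤΣ.∏ (coef γ) As)
    ℤ.+ -1ℤ ℤ.* ℤΣ.∑ (cube n) (λ γ → (coef γ φ ℤ.* χ (linFun γ z′)) ℤ.* ℤΣ.∏ (coef γ) As)
    ≡⟨ cong (λ t → ℤΣ.∑ (cube n) (λ γ → (coef γ φ ℤ.* χ (linFun γ z)) ℤ.* ℤΣ.∏ (coef γ) As) ℤ.+ t) (ℤΣ.∑-*ˡ (cube n) -1ℤ _) ⟨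
  ℤΣ.∑ (cube n) (λ γ → (coef γ φ ℤ.* χ (linFun γ z)) ℤ.* ℤΣ.∏ (coef γ) As)
    ℤ.+ ℤΣ.∑ (cube n) (λ γ → -1ℤ ℤ.* ((coef γ φ ℤ.* χ (linFun γ z′)) ℤ.* ℤΣ.∏ (coef γ) As))
    ≡⟨ ℤΣ.∑-+ (cube n) _ _ ⟨
  ℤΣ.∑ (cube n) (λ γ → (coef γ φ ℤ.* χ (linFun γ z)) ℤ.* ℤΣ.∏ (coef γ) As
                        ℤ.+ -1ℤ ℤ.* ((coef γ φ ℤ.* χ (linFun γ z′)) ℤ.* ℤΣ.∏ (coef γ) As))
    ≡⟨ ℤΣ.∑-cong (cube n) (λ γ → factor′ (coef γ φ) (χ (linFun γ z)) (χ (linFun γ z′)) (ℤΣ.∏ (coef γ) As)) ⟩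
  _ ∎
  where
  open ≡-Reasoning
  factor : ∀ k x y → k ℤ.* (x ℤ.- y) ≡ k ℤ.* x ℤ.+ -1ℤ ℤ.* (k ℤ.* y)
  factor = ℤ-Solver.solve-∀
  factor′ : ∀ f c c′ p → (f ℤ.* c) ℤ.* p ℤ.+ -1ℤ ℤ.* ((f ℤ.* c′) ℤ.* p) ≡ (f ℤ.* (c ℤ.- c′)) ℤ.* p
  factor′ = ℤ-Solver.solve-∀

-- Characters with fewer than `h` light sides take the same value at `z` and `z′` and cancel from
-- the difference. For each other character the product of the coefficients is at most `∏ size As`
-- divided by `2 ^ h`.
count-stable : ∀ {n m} (As : Vec (𝔽₂^ n → Bool) m) (φ : 𝔽₂^ n → Bool) (h : ℕ) (z z′ : 𝔽₂^ n) →
  (∀ γ → lights As γ < h → linFun γ z ≡ linFun γ z′) →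
  2 ^ h * count As φ z ≤ 2 ^ h * count As φ z′ + 2 ^ suc n * ∏ size As
count-stable {n} As φ h z z′ agree = begin
  2 ^ h * X ≤⟨ ℕₚ.*-monoʳ-≤ (2 ^ h) (triangle X X′) ⟩
  2 ^ h * (X′ + ∣ + X ℤ.- + X′ ∣) ≡⟨ ℕₚ.*-distribˡ-+ (2 ^ h) X′ _ ⟩
  2 ^ h * X′ + 2 ^ h * ∣ + X ℤ.- + X′ ∣ ≤⟨ ℕₚ.+-monoʳ-≤ (2 ^ h * X′) difference ⟩
  2 ^ h * X′ + 2 ^ suc n * ∏ size As ∎
  where
  open ℕₚ.≤-Reasoning
  X = count As φ z
  X′ = count As φ z′
  P = λ γ → ℤΣ.∏ (coef γ) As
  triangle : ∀ a b → a ≤ b + ∣ + a ℤ.- + b ∣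
  triangle a b = ℕₚ.≤-trans (ℕₚ.≤-reflexive (cong ∣_∣ (split (+ a) (+ b)))) (ℤₚ.∣i+j∣≤∣i∣+∣j∣ (+ b) (+ a ℤ.- + b))
    where
    split : ∀ i j → i ≡ j ℤ.+ (i ℤ.- j)
    split = ℤ-Solver.solve-∀
  ∣χ-χ∣≤2 : ∀ a b → ∣ χ a ℤ.- χ b ∣ ≤ 2
  ∣χ-χ∣≤2 false false = z≤n
  ∣χ-χ∣≤2 false true = ℕₚ.≤-refl
  ∣χ-χ∣≤2 true false = ℕₚ.≤-refl
  ∣χ-χ∣≤2 true true = z≤n
  gap : ∀ γ → 2 ^ h * (∣ χ (linFun γ z) ℤ.- χ (linFun γ z′) ∣ * ∣ P γ ∣) ≤ 2 * ∏ size As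
  gap γ with lights As γ <? h
  ... | yes l rewrite agree γ l | ℤₚ.i≡j⇒i-j≡0 {χ (linFun γ z′)} refl =
    ℕₚ.≤-trans (ℕₚ.≤-reflexive (ℕₚ.*-zeroʳ (2 ^ h))) z≤n
  ... | no ¬l = begin
    2 ^ h * (d * ∣ P γ ∣) ≤⟨ ℕₚ.*-monoʳ-≤ (2 ^ h) (ℕₚ.*-monoˡ-≤ ∣ P γ ∣ (∣χ-χ∣≤2 (linFun γ z) (linFun γ z′))) ⟩
    2 ^ h * (2 * ∣ P γ ∣) ≡⟨ move (2 ^ h) ∣ P γ ∣ ⟩
    2 * (2 ^ h * ∣ P γ ∣)
      ≤⟨ ℕₚ.*-monoʳ-≤ 2 (ℕₚ.*-monoˡ-≤ ∣ P γ ∣ (ℕₚ.^-monoʳ-≤ 2 (ℕₚ.≮⇒≥ ¬l))) ⟩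
    2 * (2 ^ lights As γ * ∣ P γ ∣) ≤⟨ ℕₚ.*-monoʳ-≤ 2 (lights-bound As γ) ⟩
    2 * ∏ size As ∎
    where
    d = ∣ χ (linFun γ z) ℤ.- χ (linFun γ z′) ∣
    move : ∀ a b → a * (2 * b) ≡ 2 * (a * b)
    move = ℕ-Solver.solve-∀
  reorder : ∀ a b c d → a * (b * c * d) ≡ b * (a * (c * d))
  reorder = ℕ-Solver.solve-∀
  term : ∀ γ → 2 ^ h * ∣ (coef γ φ ℤ.* (χ (linFun γ z) ℤ.- χ (linFun γ z′))) ℤ.* P γ ∣
               ≤ 2 ^ n * (2 * ∏ size As)
  term γ = begin
    2 ^ h * ∣ (coef γ φ ℤ.* Δ) ℤ.* P γ ∣
      ≡⟨ cong (2 ^ h *_) (trans (ℤₚ.abs-* (coef γ φ ℤ.* Δ) (P γ)) (cong (_* ∣ P γ ∣) (ℤₚ.abs-* (coef γ φ) Δ))) ⟩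
    2 ^ h * (∣ coef γ φ ∣ * ∣ Δ ∣ * ∣ P γ ∣) ≡⟨ reorder (2 ^ h) (∣ coef γ φ ∣) (∣ Δ ∣) (∣ P γ ∣) ⟩
    ∣ coef γ φ ∣ * (2 ^ h * (∣ Δ ∣ * ∣ P γ ∣))
      ≤⟨ ℕₚ.*-mono-≤ (ℕₚ.≤-trans (∣fourier∣≤ φ γ) (size≤ φ)) (gap γ) ⟩
    2 ^ n * (2 * ∏ size As) ∎
    where Δ = χ (linFun γ z) ℤ.- χ (linFun γ z′)
  difference : 2 ^ h * ∣ + X ℤ.- + X′ ∣ ≤ 2 ^ suc n * ∏ size As
  -- The cancelled `2 ^ n` comes from inversion. On the right one factor `2 ^ n` counts the
  -- characters and another bounds `coef γ φ`, so one of them survives, with a 2 from the difference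
  -- of two signs.
  difference = ℕₚ.*-cancelˡ-≤ (2 ^ n) {{ℕₚ.m^n≢0 2 n}} (begin
    2 ^ n * (2 ^ h * ∣ + X ℤ.- + X′ ∣) ≡⟨ *-exchange (2 ^ n) (2 ^ h) _ ⟩
    2 ^ h * (2 ^ n * ∣ + X ℤ.- + X′ ∣) ≡⟨ cong (2 ^ h *_) (ℤₚ.abs-* (+ (2 ^ n)) (+ X ℤ.- + X′)) ⟨
    2 ^ h * ∣ + (2 ^ n) ℤ.* (+ X ℤ.- + X′) ∣ ≡⟨ cong (λ s → 2 ^ h * ∣ s ∣) (count-difference As φ z z′) ⟩
    2 ^ h * ∣ ℤΣ.∑ (cube n) (λ γ → (coef γ φ ℤ.* (χ (linFun γ z) ℤ.- χ (linFun γ z′))) ℤ.* P γ) ∣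
      ≤⟨ ℕₚ.*-monoʳ-≤ (2 ^ h) (∣∑∣≤ (cube n) _) ⟩
    2 ^ h * ∑ (cube n) (λ γ → ∣ (coef γ φ ℤ.* (χ (linFun γ z) ℤ.- χ (linFun γ z′))) ℤ.* P γ ∣)
      ≡⟨ ℕΣ.∑-*ˡ (cube n) (2 ^ h) _ ⟨
    ∑ (cube n) (λ γ → 2 ^ h * ∣ (coef γ φ ℤ.* (χ (linFun γ z) ℤ.- χ (linFun γ z′))) ℤ.* P γ ∣)
      ≤⟨ ∑-mono (cube n) term ⟩
    ∑ (cube n) (λ γ → 2 ^ n * (2 * ∏ size As)) ≡⟨ ∑-const (cube n) _ ⟩
    length (cube n) * (2 ^ n * (2 * ∏ size As)) ≡⟨ cong₂ _*_ (length-cube n) (flat (2 ^ n) (∏ size As)) ⟩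
    2 ^ n * (2 ^ suc n * ∏ size As) ∎)
    where
    flat : ∀ a b → a * (2 * b) ≡ 2 * a * b
    flat = ℕ-Solver.solve-∀

-- Independent functionals

∈-vecs : ∀ {a} {A : Set a} {as : List A} → (∀ x → x ∈ as) → ∀ {m} (y : Vec A m) → y ∈ vecs as m
∈-vecs all [] = here refl
∈-vecs all (x ∷ y) = ∈-cartesianProductWith⁺ _∷_ (all x) (∈-vecs all y)

∈-bits : ∀ b → b ∈ bits
∈-bits false = here refl
∈-bits true = there (here refl)

_⊥_ : ∀ {n} → List (𝔽₂^ n) → 𝔽₂^ n → Set
ℓs ⊥ v = All (λ ℓ → linFun ℓ v ≡ false) ℓs

-- Linear independence through dual witnesses: a functional lies outside the span of the later ones
-- exactly when some vector is killed by these and not by it. The witness is what the translation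
-- argument needs.
data Independent {n : ℕ} : List (𝔽₂^ n) → Set where
  [] : Independent []
  cons : ∀ {γ ℓs} (v : 𝔽₂^ n) → ℓs ⊥ v → linFun γ v ≡ true → Independent ℓs → Independent (γ ∷ ℓs)

independent-filter : ∀ {n} {Q : 𝔽₂^ n → Set} (Q? : Decidable Q) {ℓs} →
                     Independent ℓs → Independent (filter Q? ℓs)
independent-filter Q? [] = []
independent-filter Q? (cons {γ} v ⊥v γv ind) with Q? γ
... | yes _ = cons v (filter⁺ Q? ⊥v) γv (independent-filter Q? ind)
... | no _ = independent-filter Q? ind

independent-basis : ∀ {n} (γs : List (𝔽₂^ n)) {Q : 𝔽₂^ n → Set} → All Q γs →
  ∃ λ ℓs → Independent ℓs × All Q ℓs × (∀ v → ℓs ⊥ v → γs ⊥ v)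
independent-basis [] [] = [] , [] , [] , λ v _ → []
independent-basis (γ ∷ γs) (q ∷ qs)
  with independent-basis γs qs
... | ℓs , ind , qℓs , span
  -- A subset of `Fin n` is a vector of `n` bits, so this searches the whole cube for a witness.
  with anySubset? (λ v → All.all? (λ ℓ → linFun ℓ v Boolₚ.≟ false) ℓs ×-dec (linFun γ v Boolₚ.≟ true))
... | yes (v , ⊥v , γv) = γ ∷ ℓs , cons v ⊥v γv ind , q ∷ qℓs , λ { w (γw ∷ ⊥w) → γw ∷ span w ⊥w }
... | no none = ℓs , ind , qℓs , λ w ⊥w → Boolₚ.¬-not (λ γw → none (w , ⊥w , γw)) ∷ span w ⊥w

independent-span : ∀ {n} {Q : 𝔽₂^ n → Set} → Decidable Q →
  ∃ λ ℓs → Independent ℓs × All Q ℓs × (∀ v → ℓs ⊥ v → ∀ γ → Q γ → linFun γ v ≡ false)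
independent-span {n} Q?
  with independent-basis (filter Q? (cube n)) (all-filter Q? (cube n))
... | ℓs , ind , qs , span = ℓs , ind , qs ,
  λ v ⊥v γ q → All.lookup (span v ⊥v) (∈-filter⁺ Q? (∈-vecs ∈-bits γ) q)

matches : ∀ {n} → (𝔽₂^ n → Bool) → List (𝔽₂^ n) → 𝔽₂^ n → ℕ
matches s ℓs x = ∑ ℓs (λ γ → 𝟙 (linFun γ x == s γ))

matches-⊥ : ∀ {n} (s : 𝔽₂^ n → Bool) {ℓs} {v} → ℓs ⊥ v → ∀ x → matches s ℓs (v ⊕ x) ≡ matches s ℓs x
matches-⊥ s [] x = refl
matches-⊥ s {γ ∷ ℓs} {v} (γv ∷ ⊥v) x = cong₂ _+_
  (cong (λ b → 𝟙 (b == s γ)) (trans (linFun-⊕ γ v x) (cong (_xor linFun γ x) γv)))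
  (matches-⊥ s ⊥v x)

-- Translating by the witness v of the head functional flips that functional
-- and fixes the others, so the head contributes the average (2 + 1) / 2.
∑2^matches : ∀ {n} (s : 𝔽₂^ n → Bool) {ℓs} → Independent ℓs →
             2 ^ length ℓs * ∑ (cube n) (λ x → 2 ^ matches s ℓs x) ≡ 2 ^ n * 3 ^ length ℓs
∑2^matches {n} s [] = trans (ℕₚ.+-identityʳ _)
  (trans (sym (length≡∑1 (cube n))) (trans (length-cube n) (sym (ℕₚ.*-identityʳ _))))
∑2^matches {n} s (cons {γ} {ℓs} v ⊥v γv ind) = begin
  2 * 2 ^ k * W′ ≡⟨ reorder (2 ^ k) W′ ⟩
  2 ^ k * (W′ + W′) ≡⟨ cong (2 ^ k *_) doubled ⟩
  2 ^ k * (3 * W) ≡⟨ *-exchange (2 ^ k) 3 W ⟩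
  3 * (2 ^ k * W) ≡⟨ cong (3 *_) (∑2^matches s ind) ⟩
  3 * (2 ^ n * 3 ^ k) ≡⟨ *-exchange 3 (2 ^ n) (3 ^ k) ⟩
  2 ^ n * (3 * 3 ^ k) ∎
  where
  open ≡-Reasoning
  k = length ℓs
  W = ∑ (cube n) (λ x → 2 ^ matches s ℓs x)
  W′ = ∑ (cube n) (λ x → 2 ^ matches s (γ ∷ ℓs) x)
  reorder : ∀ a w → 2 * a * w ≡ a * (w + w)
  reorder = ℕ-Solver.solve-∀
  both : ∀ b t M → 2 ^ (𝟙 (b == t) + M) + 2 ^ (𝟙 (not b == t) + M) ≡ 3 * 2 ^ M
  both false false M = ℕₚ.+-comm (2 * 2 ^ M) (2 ^ M)
  both false true M = refl
  both true false M = refl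
  both true true M = ℕₚ.+-comm (2 * 2 ^ M) (2 ^ M)
  flipped : ∀ x → 2 ^ matches s (γ ∷ ℓs) (v ⊕ x) ≡ 2 ^ (𝟙 (not (linFun γ x) == s γ) + matches s ℓs x)
  flipped x = cong₂ (λ b M → 2 ^ (𝟙 (b == s γ) + M))
    (trans (linFun-⊕ γ v x) (cong (_xor linFun γ x) γv)) (matches-⊥ s ⊥v x)
  doubled : W′ + W′ ≡ 3 * W
  doubled = begin
    W′ + W′ ≡⟨ cong (_+_ W′) (ℕΣ.∑-translate v (λ x → 2 ^ matches s (γ ∷ ℓs) x)) ⟨
    W′ + ∑ (cube n) (λ x → 2 ^ matches s (γ ∷ ℓs) (v ⊕ x)) ≡⟨ ℕΣ.∑-+ (cube n) _ _ ⟨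
    ∑ (cube n) (λ x → 2 ^ matches s (γ ∷ ℓs) x + 2 ^ matches s (γ ∷ ℓs) (v ⊕ x))
      ≡⟨ ℕΣ.∑-cong (cube n) (λ x → trans (cong (_+_ (2 ^ matches s (γ ∷ ℓs) x)) (flipped x))
                                          (both (linFun γ x) (s γ) (matches s ℓs x))) ⟩
    ∑ (cube n) (λ x → 3 * 2 ^ matches s ℓs x) ≡⟨ ℕΣ.∑-*ˡ (cube n) 3 _ ⟩
    3 * W ∎

-- Convexity and the bias of heavy characters

1+n≤2^n : ∀ n → suc n ≤ 2 ^ n
1+n≤2^n zero = s≤s z≤n
1+n≤2^n (suc n) = ℕₚ.≤-trans (ℕₚ.+-mono-≤ (ℕₚ.m^n>0 2 n) (1+n≤2^n n))
  (ℕₚ.≤-reflexive (cong (_+_ (2 ^ n)) (sym (ℕₚ.+-identityʳ _))))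

-- Convexity over the integers: the line meeting the graph of `2 ^ a` at `b` and `b + 1` lies below
-- it at every natural number. For `a ≥ b` this is `1 + d ≤ 2 ^ d`; for `a < b` the line is not
-- positive.
2^-tangent : ∀ a b → 2 ^ b * (1 + a) ≤ 2 ^ a + 2 ^ b * b
2^-tangent a b with ℕₚ.≤-total b a
... | inj₁ b≤a with ℕₚ.m≤n⇒∃[o]m+o≡n b≤a
...   | d , refl = begin
  2 ^ b * (1 + (b + d)) ≡⟨ split (2 ^ b) b d ⟩
  2 ^ b * (1 + d) + 2 ^ b * b ≤⟨ ℕₚ.+-monoˡ-≤ (2 ^ b * b) (ℕₚ.*-monoʳ-≤ (2 ^ b) (1+n≤2^n d)) ⟩
  2 ^ b * 2 ^ d + 2 ^ b * b ≡⟨ cong (_+ 2 ^ b * b) (ℕₚ.^-distribˡ-+-* 2 b d) ⟨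
  2 ^ (b + d) + 2 ^ b * b ∎
  where
  open ℕₚ.≤-Reasoning
  split : ∀ w b d → w * (1 + (b + d)) ≡ w * (1 + d) + w * b
  split = ℕ-Solver.solve-∀
2^-tangent a b | inj₂ a≤b with ℕₚ.m≤n⇒m<n∨m≡n a≤b
... | inj₁ a<b = ℕₚ.≤-trans (ℕₚ.*-monoʳ-≤ (2 ^ b) a<b) (ℕₚ.m≤n+m _ (2 ^ a))
... | inj₂ refl = ℕₚ.≤-reflexive (ℕₚ.*-suc (2 ^ a) a)

half : ∀ {n} → 𝔽₂^ n → (𝔽₂^ n → Bool) → Bool → ℕ
half {n} γ A b = ∑ (cube n) (λ x → 𝟙 (A x) * 𝟙 (linFun γ x == b))

size-halves : ∀ {n} (γ : 𝔽₂^ n) A → size A ≡ half γ A false + half γ A true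
size-halves {n} γ A = trans (ℕΣ.∑-cong (cube n) (λ x → split (𝟙 (A x)) (linFun γ x))) (ℕΣ.∑-+ (cube n) _ _)
  where
  split : ∀ a b → a ≡ a * 𝟙 (b == false) + a * 𝟙 (b == true)
  split a false = sym (trans (cong₂ _+_ (ℕₚ.*-identityʳ a) (ℕₚ.*-zeroʳ a)) (ℕₚ.+-identityʳ a))
  split a true = sym (trans (cong₂ _+_ (ℕₚ.*-zeroʳ a) (ℕₚ.*-identityʳ a)) refl)

coef-halves : ∀ {n} (γ : 𝔽₂^ n) A → coef γ A ≡ + half γ A false ℤ.- + half γ A true
coef-halves {n} γ A = begin
  coef γ A ≡⟨ ℤΣ.∑-cong (cube n) (λ x → split (𝟙 (A x)) (linFun γ x)) ⟩
  ℤΣ.∑ (cube n) (λ x → + (𝟙 (A x) * 𝟙 (linFun γ x == false)) ℤ.+ -1ℤ ℤ.* + (𝟙 (A x) * 𝟙 (linFun γ x == true)))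
    ≡⟨ ℤΣ.∑-+ (cube n) _ _ ⟩
  ℤΣ.∑ (cube n) (λ x → + (𝟙 (A x) * 𝟙 (linFun γ x == false)))
    ℤ.+ ℤΣ.∑ (cube n) (λ x → -1ℤ ℤ.* + (𝟙 (A x) * 𝟙 (linFun γ x == true)))
    ≡⟨ cong₂ ℤ._+_ (sym (+∑ (cube n) _)) (trans (ℤΣ.∑-*ˡ (cube n) -1ℤ _)
         (trans (cong (-1ℤ ℤ.*_) (sym (+∑ (cube n) _))) (ℤₚ.-1*i≡-i _))) ⟩
  + half γ A false ℤ.- + half γ A true ∎
  where
  open ≡-Reasoning
  split : ∀ a b → + a ℤ.* χ b ≡ + (a * 𝟙 (b == false)) ℤ.+ -1ℤ ℤ.* + (a * 𝟙 (b == true))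
  split a false = trans (ℤₚ.*-identityʳ (+ a)) (sym (trans
    (cong₂ (λ i j → + i ℤ.+ -1ℤ ℤ.* + j) (ℕₚ.*-identityʳ a) (ℕₚ.*-zeroʳ a)) (ℤₚ.+-identityʳ (+ a))))
  split a true = trans (ℤₚ.*-comm (+ a) -1ℤ) (sym (trans
    (cong₂ (λ i j → + i ℤ.+ -1ℤ ℤ.* + j) (ℕₚ.*-zeroʳ a) (ℕₚ.*-identityʳ a)) (ℤₚ.+-identityˡ _)))

majority : ∀ {n} → (𝔽₂^ n → Bool) → 𝔽₂^ n → Bool
majority A γ = ⌊ half γ A false ≤? half γ A true ⌋

-- Write `t = f + d`. The hypothesis amounts to `2f ≤ d`: a bias of one half puts three quarters of
-- the weight on the larger part.
skewed : ∀ f t → f ≤ t → f + t ≤ 2 * ∣ + t ℤ.- + f ∣ → 3 * (f + t) ≤ 4 * t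
skewed f t f≤t le with ℕₚ.m≤n⇒∃[o]m+o≡n f≤t
... | d , refl = begin
  3 * (f + (f + d)) ≡⟨ e₁ f d ⟩
  (f + (f + d)) + (4 * f + 2 * d) ≤⟨ ℕₚ.+-monoˡ-≤ (4 * f + 2 * d) le ⟩
  2 * ∣ + (f + d) ℤ.- + f ∣ + (4 * f + 2 * d) ≡⟨ cong (λ k → 2 * k + (4 * f + 2 * d)) gap ⟩
  2 * d + (4 * f + 2 * d) ≡⟨ e₂ f d ⟩
  4 * (f + d) ∎
  where
  open ℕₚ.≤-Reasoning
  gap : ∣ + (f + d) ℤ.- + f ∣ ≡ d
  gap = trans (cong ∣_∣ (trans (ℤₚ.m-n≡m⊖n (f + d) f) (ℤₚ.⊖-≥ f≤t))) (ℕₚ.m+n∸m≡n f d)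
  e₁ : ∀ f d → 3 * (f + (f + d)) ≡ (f + (f + d)) + (4 * f + 2 * d)
  e₁ = ℕ-Solver.solve-∀
  e₂ : ∀ f d → 2 * d + (4 * f + 2 * d) ≡ 4 * (f + d)
  e₂ = ℕ-Solver.solve-∀

-- The coefficient is the difference of the two halves and the size is their sum, so `skewed`
-- applies to the larger half; ties go to `true`.
heavy-majority : ∀ {n} {γ : 𝔽₂^ n} {A} → heavy γ A ≡ true → 3 * size A ≤ 4 * half γ A (majority A γ)
heavy-majority {γ = γ} {A} hv with size A ≤? 2 * ∣ coef γ A ∣
heavy-majority {γ = γ} {A} () | no _
... | yes le rewrite size-halves γ A | coef-halves γ A
  with half γ A false ≤? half γ A true
... | yes f≤t = skewed (half γ A false) (half γ A true) f≤t
        (subst (λ k → half γ A false + half γ A true ≤ 2 * k)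
               (ℤₚ.∣i-j∣≡∣j-i∣ (+ half γ A false) (+ half γ A true)) le)
... | no f≰t = subst (λ k → 3 * k ≤ 4 * half γ A false) (ℕₚ.+-comm (half γ A true) _)
        (skewed (half γ A true) (half γ A false) (ℕₚ.<⇒≤ (ℕₚ.≰⇒> f≰t))
          (subst (_≤ 2 * ∣ + half γ A false ℤ.- + half γ A true ∣) (ℕₚ.+-comm (half γ A false) _) le))

-- Heavy characters of a rectangle

^-distribʳ-* : ∀ k a b → (a * b) ^ k ≡ a ^ k * b ^ k
^-distribʳ-* zero a b = refl
^-distribʳ-* (suc k) a b = trans (cong (a * b *_) (^-distribʳ-* k a b)) (*-interchange a b (a ^ k) (b ^ k))

2^-cancel-≤ : ∀ a b → 2 ^ a ≤ 2 ^ b → a ≤ b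
2^-cancel-≤ a b le with ℕₚ.≤-total a b
... | inj₁ a≤b = a≤b
... | inj₂ b≤a with ℕₚ.m≤n⇒m<n∨m≡n b≤a
...   | inj₂ b≡a = ℕₚ.≤-reflexive (sym b≡a)
...   | inj₁ b<a = contradiction le (ℕₚ.<⇒≱ (ℕₚ.^-monoʳ-< 2 (s≤s (s≤s z≤n)) b<a))

-- Each heavy functional agrees with its majority value on at least 3/4 of A,
-- so the average of 2^matches over A is at least 2^(3k/4) by convexity, while
-- over the whole cube it is (3/2)^k; the gap 2^(3/4) > 3/2 bounds k.
heavy-independent-bound : ∀ {n} (A : 𝔽₂^ n → Bool) {ℓs} → Independent ℓs →
  All (λ γ → heavy γ A ≡ true) ℓs → size A ^ 8 * 2 ^ length ℓs ≤ 2 ^ 6 * (2 ^ n) ^ 8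
heavy-independent-bound {n} A {ℓs} ind hs =
  ℕₚ.*-cancelʳ-≤ _ _ (6561 ^ k) {{ℕₚ.m^n≢0 6561 k}} (begin
    S ^ 8 * 2 ^ k * 6561 ^ k ≡⟨ ℕₚ.*-assoc (S ^ 8) (2 ^ k) (6561 ^ k) ⟩
    S ^ 8 * (2 ^ k * 6561 ^ k) ≡⟨ cong (S ^ 8 *_) (^-distribʳ-* k 2 6561) ⟨
    -- Here `6561 = 3 ^ 8`. Each functional gains a factor `2 ^ (7/4) / 3`, whose eighth power
    -- exceeds 2: `2 * 3 ^ 8 = 13122`, and `2 ^ 14` is larger by 3262.
    S ^ 8 * 13122 ^ k ≤⟨ ℕₚ.*-monoʳ-≤ (S ^ 8) (ℕₚ.^-monoˡ-≤ k (ℕₚ.m≤m+n 13122 3262)) ⟩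
    S ^ 8 * (2 ^ 14) ^ k ≡⟨ cong (S ^ 8 *_) (ℕₚ.^-*-assoc 2 14 k) ⟩
    S ^ 8 * 2 ^ (14 * k) ≤⟨ ℕₚ.*-monoʳ-≤ (S ^ 8) (ℕₚ.^-monoʳ-≤ 2 exponents) ⟩
    S ^ 8 * 2 ^ (6 + (b + k) * 8) ≡⟨ cong (S ^ 8 *_) (ℕₚ.^-distribˡ-+-* 2 6 ((b + k) * 8)) ⟩
    S ^ 8 * (2 ^ 6 * 2 ^ ((b + k) * 8)) ≡⟨ *-exchange (S ^ 8) (2 ^ 6) (2 ^ ((b + k) * 8)) ⟩
    2 ^ 6 * (S ^ 8 * 2 ^ ((b + k) * 8))
      ≡⟨ cong (λ t → 2 ^ 6 * (S ^ 8 * t)) (ℕₚ.^-*-assoc 2 (b + k) 8) ⟨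
    2 ^ 6 * (S ^ 8 * (2 ^ (b + k)) ^ 8) ≡⟨ cong (2 ^ 6 *_) (^-distribʳ-* 8 S (2 ^ (b + k))) ⟨
    2 ^ 6 * (S * 2 ^ (b + k)) ^ 8 ≤⟨ ℕₚ.*-monoʳ-≤ (2 ^ 6) (ℕₚ.^-monoˡ-≤ 8 core) ⟩
    2 ^ 6 * (2 ^ n * 3 ^ k) ^ 8 ≡⟨ cong (2 ^ 6 *_) (^-distribʳ-* 8 (2 ^ n) (3 ^ k)) ⟩
    2 ^ 6 * ((2 ^ n) ^ 8 * (3 ^ k) ^ 8) ≡⟨ cong (λ t → 2 ^ 6 * ((2 ^ n) ^ 8 * t)) powers ⟩
    2 ^ 6 * ((2 ^ n) ^ 8 * 6561 ^ k) ≡⟨ ℕₚ.*-assoc (2 ^ 6) ((2 ^ n) ^ 8) (6561 ^ k) ⟨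
    2 ^ 6 * (2 ^ n) ^ 8 * 6561 ^ k ∎)
  where
  open ℕₚ.≤-Reasoning
  k = length ℓs
  -- The tangent point is the guaranteed mean number of matches on `A`, rounded down. Rounding loses
  -- at most 3/4, hence the factor `2 ^ 6` after taking eighth powers.
  b = (3 * k) / 4
  S = size A
  s = majority A
  powers : (3 ^ k) ^ 8 ≡ 6561 ^ k
  powers = trans (ℕₚ.^-*-assoc 3 k 8) (trans (cong (3 ^_) (ℕₚ.*-comm k 8)) (sym (ℕₚ.^-*-assoc 3 8 k)))
  exponents : 14 * k ≤ 6 + (b + k) * 8
  exponents = begin
    14 * k ≡⟨ e₁ k ⟩
    2 * (3 * k) + 8 * k
      ≤⟨ ℕₚ.+-monoˡ-≤ (8 * k) (ℕₚ.*-monoʳ-≤ 2 (subst (_≤ 3 + b * 4) (sym (m≡m%n+[m/n]*n (3 * k) 4))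
           (ℕₚ.+-monoˡ-≤ (b * 4) (ℕₚ.≤-pred (m%n<n (3 * k) 4))))) ⟩
    2 * (3 + b * 4) + 8 * k ≡⟨ e₂ b k ⟩
    6 + (b + k) * 8 ∎
    where
    e₁ : ∀ k → 14 * k ≡ 2 * (3 * k) + 8 * k
    e₁ = ℕ-Solver.solve-∀
    e₂ : ∀ b k → 2 * (3 + b * 4) + 8 * k ≡ 6 + (b + k) * 8
    e₂ = ℕ-Solver.solve-∀
  M = ∑ (cube n) (λ x → 𝟙 (A x) * matches s ℓs x)
  W = ∑ (cube n) (λ x → 2 ^ matches s ℓs x)
  M-halves : M ≡ ∑ ℓs (λ γ → half γ A (s γ))
  M-halves = trans (ℕΣ.∑-cong (cube n) (λ x → sym (ℕΣ.∑-*ˡ ℓs (𝟙 (A x)) _))) (ℕΣ.∑-comm (cube n) ℓs _)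
  majorities : ∀ {ℓs} → All (λ γ → heavy γ A ≡ true) ℓs →
               length ℓs * (3 * S) ≤ 4 * ∑ ℓs (λ γ → half γ A (s γ))
  majorities [] = z≤n
  majorities {γ ∷ ℓs} (hγ ∷ hs) = ℕₚ.≤-trans (ℕₚ.+-mono-≤ (heavy-majority {γ = γ} {A} hγ) (majorities hs))
    (ℕₚ.≤-reflexive (sym (ℕₚ.*-distribˡ-+ 4 (half γ A (s γ)) _)))
  bS≤M : b * S ≤ M
  bS≤M = ℕₚ.*-cancelˡ-≤ 4 (begin
    4 * (b * S) ≡⟨ e₁ b S ⟩
    b * 4 * S ≤⟨ ℕₚ.*-monoˡ-≤ S (m/n*n≤m (3 * k) 4) ⟩
    3 * k * S ≡⟨ e₂ k S ⟩
    k * (3 * S) ≤⟨ majorities hs ⟩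
    4 * ∑ ℓs (λ γ → half γ A (s γ)) ≡⟨ cong (4 *_) M-halves ⟨
    4 * M ∎)
    where
    e₁ : ∀ b S → 4 * (b * S) ≡ b * 4 * S
    e₁ = ℕ-Solver.solve-∀
    e₂ : ∀ k S → 3 * k * S ≡ k * (3 * S)
    e₂ = ℕ-Solver.solve-∀
  -- Off `A` the left side vanishes, which lets the right side range over the whole cube, where the
  -- sum of the powers is known exactly.
  tangent : ∀ x → 2 ^ b * (𝟙 (A x) + 𝟙 (A x) * matches s ℓs x) ≤ 2 ^ matches s ℓs x + 2 ^ b * b * 𝟙 (A x)
  tangent x with A x
  ... | false = ℕₚ.≤-trans (ℕₚ.≤-reflexive (ℕₚ.*-zeroʳ (2 ^ b))) z≤n
  ... | true = subst₂ (λ u v → 2 ^ b * suc u ≤ 2 ^ matches s ℓs x + v)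
    (sym (ℕₚ.+-identityʳ (matches s ℓs x))) (sym (ℕₚ.*-identityʳ (2 ^ b * b))) (2^-tangent (matches s ℓs x) b)
  convexity : 2 ^ b * S ≤ W
  convexity = ℕₚ.+-cancelʳ-≤ (2 ^ b * b * S) _ _ (begin
    2 ^ b * S + 2 ^ b * b * S ≡⟨ e (2 ^ b) b S ⟩
    2 ^ b * (S + b * S) ≤⟨ ℕₚ.*-monoʳ-≤ (2 ^ b) (ℕₚ.+-monoʳ-≤ S bS≤M) ⟩
    2 ^ b * (S + M) ≡⟨ cong (2 ^ b *_) (ℕΣ.∑-+ (cube n) _ _) ⟨
    2 ^ b * ∑ (cube n) (λ x → 𝟙 (A x) + 𝟙 (A x) * matches s ℓs x) ≡⟨ ℕΣ.∑-*ˡ (cube n) (2 ^ b) _ ⟨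
    ∑ (cube n) (λ x → 2 ^ b * (𝟙 (A x) + 𝟙 (A x) * matches s ℓs x)) ≤⟨ ∑-mono (cube n) tangent ⟩
    ∑ (cube n) (λ x → 2 ^ matches s ℓs x + 2 ^ b * b * 𝟙 (A x)) ≡⟨ ℕΣ.∑-+ (cube n) _ _ ⟩
    W + ∑ (cube n) (λ x → 2 ^ b * b * 𝟙 (A x)) ≡⟨ cong (_+_ W) (ℕΣ.∑-*ˡ (cube n) (2 ^ b * b) _) ⟩
    W + 2 ^ b * b * S ∎)
    where
    e : ∀ w b S → w * S + w * b * S ≡ w * (S + b * S)
    e = ℕ-Solver.solve-∀
  core : S * 2 ^ (b + k) ≤ 2 ^ n * 3 ^ k
  core = begin
    S * 2 ^ (b + k) ≡⟨ cong (S *_) (ℕₚ.^-distribˡ-+-* 2 b k) ⟩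
    S * (2 ^ b * 2 ^ k) ≡⟨ e S (2 ^ b) (2 ^ k) ⟩
    2 ^ k * (2 ^ b * S) ≤⟨ ℕₚ.*-monoʳ-≤ (2 ^ k) convexity ⟩
    2 ^ k * W ≡⟨ ∑2^matches s ind ⟩
    2 ^ n * 3 ^ k ∎
    where
    e : ∀ S b k → S * (b * k) ≡ k * (b * S)
    e = ℕ-Solver.solve-∀

module _ {n : ℕ} (ℓs : List (𝔽₂^ n)) where

  heavies : (𝔽₂^ n → Bool) → List (𝔽₂^ n)
  heavies A = filter (λ γ → heavy γ A Boolₚ.≟ true) ℓs

  ∑heavies : ∀ {m} → Vec (𝔽₂^ n → Bool) m → ℕ
  ∑heavies As = ∑ (Vec.toList As) (λ A → length (heavies A))

  -- The members of `ℓs` that are heavy for a given side are still independent, and the bounds for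
  -- the single sides multiply.
  ∏heavy-bound : Independent ℓs → ∀ {m} (As : Vec (𝔽₂^ n → Bool) m) →
    ∏ size As ^ 8 * 2 ^ ∑heavies As ≤ 2 ^ (6 * m) * (2 ^ (n * m)) ^ 8
  ∏heavy-bound ind [] rewrite ℕₚ.*-zeroʳ n = ℕₚ.≤-refl
  ∏heavy-bound ind {suc m} (A ∷ As) = begin
    (size A * ∏ size As) ^ 8 * 2 ^ (length (heavies A) + ∑heavies As)
      ≡⟨ cong₂ _*_ (^-distribʳ-* 8 (size A) _) (ℕₚ.^-distribˡ-+-* 2 (length (heavies A)) _) ⟩
    (size A ^ 8 * ∏ size As ^ 8) * (2 ^ length (heavies A) * 2 ^ ∑heavies As)
      ≡⟨ *-interchange (size A ^ 8) _ _ _ ⟩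
    (size A ^ 8 * 2 ^ length (heavies A)) * (∏ size As ^ 8 * 2 ^ ∑heavies As)
      ≤⟨ ℕₚ.*-mono-≤ (heavy-independent-bound A (independent-filter _ ind)
                        (all-filter (λ γ → heavy γ A Boolₚ.≟ true) ℓs))
                     (∏heavy-bound ind As) ⟩
    (2 ^ 6 * (2 ^ n) ^ 8) * (2 ^ (6 * m) * (2 ^ (n * m)) ^ 8)
      ≡⟨ *-interchange (2 ^ 6) ((2 ^ n) ^ 8) (2 ^ (6 * m)) ((2 ^ (n * m)) ^ 8) ⟩
    (2 ^ 6 * 2 ^ (6 * m)) * ((2 ^ n) ^ 8 * (2 ^ (n * m)) ^ 8)
      ≡⟨ cong₂ _*_ (trans (sym (ℕₚ.^-distribˡ-+-* 2 6 (6 * m))) (cong (2 ^_) (sym (ℕₚ.*-suc 6 m))))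
                   (trans (sym (^-distribʳ-* 8 (2 ^ n) (2 ^ (n * m))))
                          (cong (_^ 8) (trans (sym (ℕₚ.^-distribˡ-+-* 2 n (n * m))) (cong (2 ^_) (sym (ℕₚ.*-suc n m)))))) ⟩
    2 ^ (6 * suc m) * (2 ^ (n * suc m)) ^ 8 ∎
    where
    open ℕₚ.≤-Reasoning

  -- Double counting of the pairs of a functional and a side.
  heavies-lights : ∀ {m} (As : Vec (𝔽₂^ n → Bool) m) → length ℓs * m ≡ ∑heavies As + ∑ ℓs (lights As)
  heavies-lights [] = trans (ℕₚ.*-zeroʳ (length ℓs)) (sym (ℕΣ.∑-0 ℓs))
  heavies-lights {suc m} (A ∷ As) = begin
    length ℓs * suc m ≡⟨ ℕₚ.*-suc (length ℓs) m ⟩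
    length ℓs + length ℓs * m ≡⟨ cong₂ _+_ (split ℓs) (heavies-lights As) ⟩
    (length (heavies A) + ∑ ℓs (λ γ → 𝟙 (not (heavy γ A)))) + (∑heavies As + ∑ ℓs (lights As))
      ≡⟨ swap (length (heavies A)) _ _ _ ⟩
    (length (heavies A) + ∑heavies As) + (∑ ℓs (λ γ → 𝟙 (not (heavy γ A))) + ∑ ℓs (lights As))
      ≡⟨ cong (_+_ (length (heavies A) + ∑heavies As)) (ℕΣ.∑-+ ℓs _ _) ⟨
    ∑heavies (A ∷ As) + ∑ ℓs (lights (A ∷ As)) ∎
    where
    open ≡-Reasoning
    swap : ∀ a b c d → (a + b) + (c + d) ≡ (a + c) + (b + d)
    swap = ℕ-Solver.solve-∀
    split : ∀ γs → length γs ≡ length (filter (λ γ → heavy γ A Boolₚ.≟ true) γs) + ∑ γs (λ γ → 𝟙 (not (heavy γ A)))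
    split [] = refl
    split (γ ∷ γs) with heavy γ A
    ... | true = cong suc (split γs)
    ... | false = trans (cong suc (split γs)) (sym (ℕₚ.+-suc _ _))

-- At most half of the pairs of a functional and a side are light, so the number `H` of heavy pairs
-- is at least half of all. Density at least `2 ^ -(2cm)` turns the product bound into
-- `H ≤ 6m + 16cm`, and dividing `2 * H` by `m` gives the constants.
independent-length : ∀ {n m} c (As : Vec (𝔽₂^ n → Bool) m) → 0 < m → ∀ h → 2 * h ≤ m → ∀ {ℓs} →
  Independent ℓs → All (λ γ → lights As γ < h) ℓs →
  2 ^ (n * m) ≤ ∏ size As * 2 ^ (2 * (c * m)) → length ℓs ≤ 12 + 32 * c
independent-length {n} {m} c As 0<m h 2h≤m {ℓs} ind lt large =
  ℕₚ.*-cancelʳ-≤ (length ℓs) (12 + 32 * c) m {{>-nonZero 0<m}} (begin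
    length ℓs * m ≤⟨ mostly-heavy ⟩
    2 * H ≤⟨ ℕₚ.*-monoʳ-≤ 2 (2^-cancel-≤ H (6 * m + 2 * (c * m) * 8) 2^H≤) ⟩
    2 * (6 * m + 2 * (c * m) * 8) ≡⟨ e m c ⟩
    (12 + 32 * c) * m ∎)
  where
  open ℕₚ.≤-Reasoning
  H = ∑heavies ℓs As
  e : ∀ m c → 2 * (6 * m + 2 * (c * m) * 8) ≡ (12 + 32 * c) * m
  e = ℕ-Solver.solve-∀
  ∑lights : ∀ {γs} → All (λ γ → lights As γ < h) γs → ∑ γs (lights As) ≤ length γs * h
  ∑lights [] = z≤n
  ∑lights (l ∷ ls) = ℕₚ.+-mono-≤ (ℕₚ.<⇒≤ l) (∑lights ls)
  mostly-heavy : length ℓs * m ≤ 2 * H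
  mostly-heavy = ℕₚ.+-cancelʳ-≤ (length ℓs * m) _ _ (begin
    length ℓs * m + length ℓs * m ≡⟨ cong (λ t → t + t) (heavies-lights ℓs As) ⟩
    (H + ∑ ℓs (lights As)) + (H + ∑ ℓs (lights As)) ≡⟨ e₁ H _ ⟩
    2 * H + 2 * ∑ ℓs (lights As) ≤⟨ ℕₚ.+-monoʳ-≤ (2 * H) (ℕₚ.*-monoʳ-≤ 2 (∑lights lt)) ⟩
    2 * H + 2 * (length ℓs * h) ≡⟨ e₂ H (length ℓs) h ⟩
    2 * H + length ℓs * (2 * h) ≤⟨ ℕₚ.+-monoʳ-≤ (2 * H) (ℕₚ.*-monoʳ-≤ (length ℓs) 2h≤m) ⟩
    2 * H + length ℓs * m ∎)
    where
    e₁ : ∀ H l → (H + l) + (H + l) ≡ 2 * H + 2 * l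
    e₁ = ℕ-Solver.solve-∀
    e₂ : ∀ H l h → 2 * H + 2 * (l * h) ≡ 2 * H + l * (2 * h)
    e₂ = ℕ-Solver.solve-∀
  T = 2 ^ (n * m)
  2^H≤ : 2 ^ H ≤ 2 ^ (6 * m + 2 * (c * m) * 8)
  2^H≤ = ℕₚ.*-cancelˡ-≤ (T ^ 8) {{ℕₚ.m^n≢0 T 8 {{ℕₚ.m^n≢0 2 (n * m)}}}} (begin
    T ^ 8 * 2 ^ H ≤⟨ ℕₚ.*-monoˡ-≤ (2 ^ H) (ℕₚ.^-monoˡ-≤ 8 large) ⟩
    (∏ size As * 2 ^ (2 * (c * m))) ^ 8 * 2 ^ H ≡⟨ cong (_* 2 ^ H) (^-distribʳ-* 8 (∏ size As) _) ⟩
    ∏ size As ^ 8 * (2 ^ (2 * (c * m))) ^ 8 * 2 ^ H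
      ≡⟨ cong (λ t → ∏ size As ^ 8 * t * 2 ^ H) (ℕₚ.^-*-assoc 2 (2 * (c * m)) 8) ⟩
    ∏ size As ^ 8 * 2 ^ (2 * (c * m) * 8) * 2 ^ H ≡⟨ e₁ (∏ size As ^ 8) _ _ ⟩
    ∏ size As ^ 8 * 2 ^ H * 2 ^ (2 * (c * m) * 8) ≤⟨ ℕₚ.*-monoˡ-≤ _ (∏heavy-bound ℓs ind As) ⟩
    2 ^ (6 * m) * T ^ 8 * 2 ^ (2 * (c * m) * 8) ≡⟨ e₂ (2 ^ (6 * m)) (T ^ 8) _ ⟩
    T ^ 8 * (2 ^ (6 * m) * 2 ^ (2 * (c * m) * 8)) ≡⟨ cong (T ^ 8 *_) (ℕₚ.^-distribˡ-+-* 2 (6 * m) _) ⟨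
    T ^ 8 * 2 ^ (6 * m + 2 * (c * m) * 8) ∎)
    where
    e₁ : ∀ a b c → a * b * c ≡ a * c * b
    e₁ = ℕ-Solver.solve-∀
    e₂ : ∀ a b c → a * b * c ≡ b * (a * c)
    e₂ = ℕ-Solver.solve-∀

-- Transcripts and rectangles

_≟ᵐ_ : ∀ {c} → DecidableEquality (Vec Bool c)
_≟ᵐ_ = Vecₚ.≡-dec Boolₚ._≟_

_≟ᵗ_ : ∀ {c m} → DecidableEquality (Vec (Vec Bool c) m)
_≟ᵗ_ = Vecₚ.≡-dec _≟ᵐ_

⌊⌋-true : ∀ {p} {P : Set p} (P? : Dec P) → ⌊ P? ⌋ ≡ true → P
⌊⌋-true (yes p) _ = p

true-⌊⌋ : ∀ {p} {P : Set p} (P? : Dec P) → P → ⌊ P? ⌋ ≡ true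
true-⌊⌋ (yes _) _ = refl
true-⌊⌋ (no ¬p) p = contradiction p ¬p

truncate-∷ʳ : ∀ {A : Set} {k m} (k<m : k < m) (k≤m : k ≤ m) (t : Vec A m) →
              truncate k<m t ≡ truncate k≤m t ∷ʳ lookup t (fromℕ< k<m)
truncate-∷ʳ {k = zero} (s≤s z≤n) z≤n (x ∷ t) = refl
truncate-∷ʳ {k = suc k} (s≤s k<m) (s≤s k≤m) (x ∷ t) = cong (x ∷_) (truncate-∷ʳ k<m k≤m t)

lookup-∷ʳ-< : ∀ {A : Set} {k m} (y : Vec A m) z (k<m : k < m) (k<1+m : k < suc m) →
              lookup (y ∷ʳ z) (fromℕ< k<1+m) ≡ lookup y (fromℕ< k<m)
lookup-∷ʳ-< {k = zero} (x ∷ y) z (s≤s k<m) (s≤s k<1+m) = refl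
lookup-∷ʳ-< {k = suc k} (x ∷ y) z (s≤s k<m) (s≤s k<1+m) = lookup-∷ʳ-< y z k<m k<1+m

lookup-∷ʳ-last : ∀ {A : Set} {m} (y : Vec A m) z → lookup (y ∷ʳ z) (fromℕ m) ≡ z
lookup-∷ʳ-last [] z = refl
lookup-∷ʳ-last (x ∷ y) z = lookup-∷ʳ-last y z

inRect-tabulate : ∀ {A : Set} {m} (F : Fin m → A → Bool) y →
                  (inRect (tabulate F) y ≡ true → ∀ i → F i (lookup y i) ≡ true) ×
                  ((∀ i → F i (lookup y i) ≡ true) → inRect (tabulate F) y ≡ true)
inRect-tabulate F [] = (λ _ ()) , (λ _ → refl)
inRect-tabulate F (x ∷ y) = fwd , bwd
  where
  fwd : F Fin.zero x ∧ inRect (tabulate (F ∘ Fin.suc)) y ≡ true → ∀ i → F i (lookup (x ∷ y) i) ≡ true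
  fwd e with F Fin.zero x in eq
  ... | true = λ { Fin.zero → eq ; (Fin.suc i) → proj₁ (inRect-tabulate (F ∘ Fin.suc) y) e i }
  bwd : (∀ i → F i (lookup (x ∷ y) i) ≡ true) → F Fin.zero x ∧ inRect (tabulate (F ∘ Fin.suc)) y ≡ true
  bwd all rewrite all Fin.zero = proj₂ (inRect-tabulate (F ∘ Fin.suc) y) (all ∘ Fin.suc)

module _ {n m c R : ℕ} (P : Protocol n m c R) (r : Vec Bool R) where
  open Protocol P

  transcriptOf : Vec (𝔽₂^ n) m → 𝔽₂^ n → Vec (Vec Bool c) m
  transcriptOf y z = transcript P (y ∷ʳ z) r m ℕₚ.≤-refl

  module _ (t : Vec (Vec Bool c) m) where

    -- The earlier messages are read off `t` instead of being computed, so the condition concerns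
    -- the input of player `k` alone. This is why the inputs producing `t` form a rectangle.
    sends : (k : ℕ) → k < m → 𝔽₂^ n → Bool
    sends k k<m x = ⌊ msg k k<m x (truncate (ℕₚ.<⇒≤ k<m) t) r ≟ᵐ lookup t (fromℕ< k<m) ⌋

    rect : Vec (𝔽₂^ n → Bool) m
    rect = tabulate (λ i → sends (toℕ i) (Finₚ.toℕ<n i))

    module _ (y : Vec (𝔽₂^ n) m) (z : 𝔽₂^ n) where

      Sent : (k : ℕ) → k < m → Set
      Sent k k<m = sends k k<m (lookup y (fromℕ< k<m)) ≡ true

      transcript-sent : ∀ k (k≤m : k ≤ m) → transcript P (y ∷ʳ z) r k k≤m ≡ truncate k≤m t →
                        ∀ j (j<m : j < m) → j < k → Sent j j<m
      transcript-sent (suc k) k<m@(s≤s k≤m′) e j j<m (s≤s j≤k)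
        with Vecₚ.∷ʳ-injective _ _ (trans e (truncate-∷ʳ k<m (ℕₚ.m≤n⇒m≤1+n k≤m′) t))
           | ℕₚ.m≤n⇒m<n∨m≡n j≤k
      ... | prev , last | inj₁ j<k = transcript-sent k (ℕₚ.m≤n⇒m≤1+n k≤m′) prev j j<m j<k
      -- `msg` takes the proof of `k < m` as an argument, so the two proofs must be identified
      -- before the messages can be compared.
      ... | prev , last | inj₂ refl
        rewrite ℕₚ.≤-irrelevant j<m k<m = true-⌊⌋ (_ ≟ᵐ _) (begin
          msg k k<m (lookup y (fromℕ< k<m)) (truncate (ℕₚ.<⇒≤ k<m) t) r
            ≡⟨ cong₂ (λ x p → msg k k<m x p r)
                     (sym (lookup-∷ʳ-< y z k<m (ℕₚ.m<n⇒m<1+n k<m)))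
                     (trans (Vecₚ.truncate-irrelevant _ (ℕₚ.m≤n⇒m≤1+n k≤m′) t) (sym prev)) ⟩
          _ ≡⟨ last ⟩
          lookup t (fromℕ< k<m) ∎)
        where
        open ≡-Reasoning

      sent-transcript : ∀ k (k≤m : k ≤ m) → (∀ j (j<m : j < m) → j < k → Sent j j<m) →
                        transcript P (y ∷ʳ z) r k k≤m ≡ truncate k≤m t
      sent-transcript zero k≤m all = refl
      sent-transcript (suc k) k<m@(s≤s k≤m′) all =
        trans (cong₂ _∷ʳ_ prev last) (sym (truncate-∷ʳ k<m (ℕₚ.m≤n⇒m≤1+n k≤m′) t))
        where
        prev = sent-transcript k (ℕₚ.m≤n⇒m≤1+n k≤m′) (λ j j<m j<k → all j j<m (ℕₚ.m≤n⇒m≤1+n j<k))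
        last : msg k k<m (lookup (y ∷ʳ z) (fromℕ< (ℕₚ.m<n⇒m<1+n k<m)))
                   (transcript P (y ∷ʳ z) r k (ℕₚ.m≤n⇒m≤1+n k≤m′)) r ≡ lookup t (fromℕ< k<m)
        last = trans
          (cong₂ (λ x p → msg k k<m x p r)
                 (lookup-∷ʳ-< y z k<m (ℕₚ.m<n⇒m<1+n k<m))
                 (trans prev (Vecₚ.truncate-irrelevant (ℕₚ.m≤n⇒m≤1+n k≤m′) _ t)))
          (⌊⌋-true (_ ≟ᵐ _) (all k k<m ℕₚ.≤-refl))

      rect-transcript : inRect rect y ≡ true → transcriptOf y z ≡ t
      rect-transcript e = trans (sent-transcript m ℕₚ.≤-refl (λ j j<m _ → sent j j<m)) (Vecₚ.truncate-refl t)
        where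
        -- Generalising over `j` lets `toℕ i ≡ j` be matched with `refl`, which carries a fact
        -- indexed by `Fin m` over to the bounded naturals of `Sent`.
        sentBy : ∀ i {j} (j<m : j < m) → toℕ i ≡ j → Sent j j<m
        sentBy i j<m refl rewrite ℕₚ.≤-irrelevant j<m (Finₚ.toℕ<n i) =
          subst (λ i′ → sends (toℕ i) (Finₚ.toℕ<n i) (lookup y i′) ≡ true)
                (sym (Finₚ.fromℕ<-toℕ i (Finₚ.toℕ<n i)))
                (proj₁ (inRect-tabulate (λ i → sends (toℕ i) (Finₚ.toℕ<n i)) y) e i)
        sent : ∀ j (j<m : j < m) → Sent j j<m
        sent j j<m = sentBy (fromℕ< j<m) j<m (Finₚ.toℕ-fromℕ< j<m)

      transcript-rect : transcriptOf y z ≡ t → inRect rect y ≡ true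
      transcript-rect e = proj₂ (inRect-tabulate (λ i → sends (toℕ i) (Finₚ.toℕ<n i)) y) (λ i →
        subst (λ i′ → sends (toℕ i) (Finₚ.toℕ<n i) (lookup y i′) ≡ true)
              (Finₚ.fromℕ<-toℕ i (Finₚ.toℕ<n i))
              (transcript-sent m ℕₚ.≤-refl (trans e (sym (Vecₚ.truncate-refl t)))
                (toℕ i) (Finₚ.toℕ<n i) (Finₚ.toℕ<n i)))

      -- Both directions are inductions along the players. Only the first `m` players contribute to
      -- the transcript, so the last input `z` is arbitrary.
      inRect-rect : inRect rect y ≡ ⌊ transcriptOf y z ≟ᵗ t ⌋
      inRect-rect with transcriptOf y z ≟ᵗ t
      ... | yes e = transcript-rect e
      ... | no ¬e = Boolₚ.¬-not (¬e ∘ rect-transcript)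

-- Simulating the last player by a junta

-- Says that `as` lists each element exactly once, in the form in which it is applied: summation
-- against a Kronecker delta.
∑-δ : ∀ {A : Set} → DecidableEquality A → List A → Set
∑-δ {A} _≟_ as = ∀ s (g : A → ℕ) → ∑ as (λ t → 𝟙 ⌊ s ≟ t ⌋ * g t) ≡ g s

∑-δ-bits : ∑-δ Boolₚ._≟_ bits
∑-δ-bits false g = trans (ℕₚ.+-identityʳ _) (ℕₚ.+-identityʳ _)
∑-δ-bits true g = trans (ℕₚ.+-identityʳ _) (ℕₚ.+-identityʳ _)

∑-δ-vecs : ∀ {A : Set} {_≟_ : DecidableEquality A} {as} → ∑-δ _≟_ as →
           ∀ m → ∑-δ (Vecₚ.≡-dec _≟_) (vecs as m)
∑-δ-vecs δ zero [] g = trans (ℕₚ.+-identityʳ _) (ℕₚ.+-identityʳ _)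
∑-δ-vecs {_≟_ = _≟_} {as} δ (suc m) (x ∷ xs) g = begin
  ∑ (vecs as (suc m)) (λ t → 𝟙 ⌊ Vecₚ.≡-dec _≟_ (x ∷ xs) t ⌋ * g t)
    ≡⟨ ℕΣ.∑-vecs-suc as m _ ⟩
  ∑ as (λ y → ∑ (vecs as m) (λ ys → 𝟙 ⌊ Vecₚ.≡-dec _≟_ (x ∷ xs) (y ∷ ys) ⌋ * g (y ∷ ys)))
    ≡⟨ ℕΣ.∑-cong as (λ y → ℕΣ.∑-cong (vecs as m) (λ ys → factor y ys (g (y ∷ ys)))) ⟩
  ∑ as (λ y → ∑ (vecs as m) (λ ys → 𝟙 ⌊ x ≟ y ⌋ * (𝟙 ⌊ Vecₚ.≡-dec _≟_ xs ys ⌋ * g (y ∷ ys))))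
    ≡⟨ ℕΣ.∑-cong as (λ y → trans (ℕΣ.∑-*ˡ (vecs as m) (𝟙 ⌊ x ≟ y ⌋) _)
         (cong (𝟙 ⌊ x ≟ y ⌋ *_) (∑-δ-vecs δ m xs (λ ys → g (y ∷ ys))))) ⟩
  ∑ as (λ y → 𝟙 ⌊ x ≟ y ⌋ * g (y ∷ xs)) ≡⟨ δ x (λ y → g (y ∷ xs)) ⟩
  g (x ∷ xs) ∎
  where
  open ≡-Reasoning
  factor : ∀ y ys k → 𝟙 ⌊ Vecₚ.≡-dec _≟_ (x ∷ xs) (y ∷ ys) ⌋ * k
                      ≡ 𝟙 ⌊ x ≟ y ⌋ * (𝟙 ⌊ Vecₚ.≡-dec _≟_ xs ys ⌋ * k)
  factor y ys k with x ≟ y | Vecₚ.≡-dec _≟_ xs ys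
  ... | yes _ | yes _ = sym (ℕₚ.+-identityʳ _)
  ... | yes _ | no _ = refl
  ... | no _ | yes _ = refl
  ... | no _ | no _ = refl

-- A junta must have exactly `K` functionals. The zero functional fills free places; with the final
-- `K`, a basis can be cut off only for a rectangle of negligible measure.
pad : ∀ {n} K → List (𝔽₂^ n) → Vec (𝔽₂^ n) K
pad zero _ = []
pad (suc K) [] = 𝟎 ∷ pad K []
pad (suc K) (ℓ ∷ ℓs) = ℓ ∷ pad K ℓs

values : ∀ {n K} → Vec (𝔽₂^ n) K → 𝔽₂^ n → Vec Bool K
values ℓs x = Vec.map (λ ℓ → linFun ℓ x) ℓs

linFun-agree : ∀ {n} (γ x x′ : 𝔽₂^ n) → linFun γ x ≡ linFun γ x′ → linFun γ (x ⊕ x′) ≡ false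
linFun-agree γ x x′ e = trans (linFun-⊕ γ x x′)
  (trans (cong (_xor linFun γ x′) e) (Boolₚ.xor-same (linFun γ x′)))

linFun-agree⁻¹ : ∀ {n} (γ x x′ : 𝔽₂^ n) → linFun γ (x ⊕ x′) ≡ false → linFun γ x ≡ linFun γ x′
linFun-agree⁻¹ γ x x′ e = xor-false (linFun γ x) (linFun γ x′) (trans (sym (linFun-⊕ γ x x′)) e)
  where
  xor-false : ∀ a b → a xor b ≡ false → a ≡ b
  xor-false false false _ = refl
  xor-false true true _ = refl

values-pad : ∀ {n} K (ℓs : List (𝔽₂^ n)) (x x′ : 𝔽₂^ n) → length ℓs ≤ K →
             values (pad K ℓs) x ≡ values (pad K ℓs) x′ → ℓs ⊥ (x ⊕ x′)
values-pad K [] x x′ le e = []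
values-pad (suc K) (ℓ ∷ ℓs) x x′ (s≤s le) e with Vecₚ.∷-injective e
... | e₁ , e₂ = linFun-agree ℓ x x′ e₁ ∷ values-pad K ℓs x x′ le e₂

-- For a `v` that is not attained, `𝟎` is a placeholder; the values of an actual input are always
-- attained.
preimage : ∀ {n K} → Vec (𝔽₂^ n) K → Vec Bool K → 𝔽₂^ n
preimage ℓs v with anySubset? (λ x → values ℓs x ≟ᵐ v)
... | yes (x , _) = x
... | no _ = 𝟎

values-preimage : ∀ {n K} (ℓs : Vec (𝔽₂^ n) K) x → values ℓs (preimage ℓs (values ℓs x)) ≡ values ℓs x
values-preimage ℓs x with anySubset? (λ x′ → values ℓs x′ ≟ᵐ values ℓs x)
... | yes (_ , e) = e
... | no none = contradiction (x , refl) none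

count≤∏size : ∀ {n m} (As : Vec (𝔽₂^ n → Bool) m) φ z → count As φ z ≤ ∏ size As
count≤∏size {n} {m} As φ z = ℕₚ.≤-trans
  (∑-mono (vecs (cube n) m) (λ y → ℕₚ.≤-trans (ℕₚ.*-monoʳ-≤ (𝟙 (inRect As y)) (𝟙≤1 (φ (z ⊕ sumVecs y))))
                                              (ℕₚ.≤-reflexive (ℕₚ.*-identityʳ _))))
  (ℕₚ.≤-reflexive (∏size As))

module _ {n m : ℕ} (K : ℕ) (As : Vec (𝔽₂^ n → Bool) m) where

  private
    basis = independent-span (λ γ → lights As γ <? ⌊ m /2⌋)

  heavyBasis : Vec (𝔽₂^ n) K
  heavyBasis = pad K (proj₁ basis)

  -- The vector `x′` of the sketch: it depends on `x` only through the values of the functionals in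
  -- `heavyBasis`.
  represent : 𝔽₂^ n → 𝔽₂^ n
  represent x = preimage heavyBasis (values heavyBasis x)

  2⌊m/2⌋≤m : 2 * ⌊ m /2⌋ ≤ m
  2⌊m/2⌋≤m = ℕₚ.≤-trans (ℕₚ.≤-reflexive (cong (_+_ ⌊ m /2⌋) (ℕₚ.+-identityʳ _)))
    (ℕₚ.≤-trans (ℕₚ.+-monoʳ-≤ ⌊ m /2⌋ (ℕₚ.⌊n/2⌋≤⌈n/2⌉ m)) (ℕₚ.≤-reflexive (ℕₚ.⌊n/2⌋+⌈n/2⌉≡n m)))

  -- The length bound ensures that padding drops no basis functional. Hence `x ⊕ represent x` is
  -- annihilated by the whole basis, therefore by every heavy character, and `count-stable` applies.
  represent-large : ∀ c → 0 < m → 12 + 32 * c ≤ K → 2 ^ (n * m) ≤ ∏ size As * 2 ^ (2 * (c * m)) →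
    ∀ φ x → 2 ^ ⌊ m /2⌋ * count As φ x ≤ 2 ^ ⌊ m /2⌋ * count As φ (represent x) + 2 ^ suc n * ∏ size As
  represent-large c 0<m c≤K large φ x = count-stable As φ ⌊ m /2⌋ x (represent x) agree
    where
    ind = proj₁ (proj₂ basis)
    lts = proj₁ (proj₂ (proj₂ basis))
    span = proj₂ (proj₂ (proj₂ basis))
    agree : ∀ γ → lights As γ < ⌊ m /2⌋ → linFun γ x ≡ linFun γ (represent x)
    agree γ lt = linFun-agree⁻¹ γ x (represent x)
      (span (x ⊕ represent x)
            (values-pad K (proj₁ basis) x (represent x)
              (ℕₚ.≤-trans (independent-length c As 0<m ⌊ m /2⌋ 2⌊m/2⌋≤m ind lts large) c≤K)
              (sym (values-preimage heavyBasis x)))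
            γ lt)

  -- A rectangle of measure below 2^(-2cm) is too small to matter even when
  -- multiplied by the number 2^(cm) of transcripts.
  represent-count : ∀ c → 0 < c → 0 < m → 12 + 32 * c ≤ K → ∀ φ x →
    2 ^ (c * m) * (2 ^ ⌊ m /2⌋ * count As φ x) ≤
    2 ^ (c * m) * (2 ^ ⌊ m /2⌋ * count As φ (represent x) + 2 ^ suc n * ∏ size As) + 2 ^ (n * m)
  represent-count c 0<c 0<m c≤K φ x with 2 ^ (n * m) ≤? ∏ size As * 2 ^ (2 * (c * m))
  ... | yes large = ℕₚ.≤-trans (ℕₚ.*-monoʳ-≤ (2 ^ (c * m)) (represent-large c 0<m c≤K large φ x))
                               (ℕₚ.m≤m+n _ _)
  ... | no small = ℕₚ.≤-trans (begin
    2 ^ (c * m) * (2 ^ ⌊ m /2⌋ * count As φ x)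
      ≤⟨ ℕₚ.*-monoʳ-≤ (2 ^ (c * m)) (ℕₚ.*-mono-≤ (ℕₚ.^-monoʳ-≤ 2 h≤cm) (count≤∏size As φ x)) ⟩
    2 ^ (c * m) * (2 ^ (c * m) * ∏ size As) ≡⟨ e (2 ^ (c * m)) (∏ size As) ⟩
    ∏ size As * (2 ^ (c * m) * 2 ^ (c * m)) ≡⟨ cong (∏ size As *_) (ℕₚ.^-distribˡ-+-* 2 (c * m) (c * m)) ⟨
    ∏ size As * 2 ^ (c * m + c * m) ≡⟨ cong (λ k → ∏ size As * 2 ^ (c * m + k)) (ℕₚ.+-identityʳ (c * m)) ⟨
    ∏ size As * 2 ^ (2 * (c * m)) ≤⟨ ℕₚ.<⇒≤ (ℕₚ.≰⇒> small) ⟩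
    2 ^ (n * m) ∎) (ℕₚ.m≤n+m _ _)
    where
    open ℕₚ.≤-Reasoning
    e : ∀ w s → w * (w * s) ≡ s * (w * w)
    e = ℕ-Solver.solve-∀
    -- As `c` is positive, the scale `2 ^ ⌊ m /2⌋` is at most `2 ^ (c * m)`, which uses up the
    -- second of the two factors in `2 ^ (2 * (c * m))`.
    h≤cm : ⌊ m /2⌋ ≤ c * m
    h≤cm = ℕₚ.≤-trans (ℕₚ.⌊n/2⌋≤n m) (ℕₚ.≤-trans (ℕₚ.≤-reflexive (sym (ℕₚ.*-identityˡ m))) (ℕₚ.*-monoˡ-≤ m 0<c))

length-vecs-cube : ∀ n m → length (vecs (cube n) m) ≡ 2 ^ (n * m)
length-vecs-cube n m = trans (length-vecs (cube n) m) (trans (cong (_^ m) (length-cube n)) (ℕₚ.^-*-assoc 2 n m))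

module _ {n m c R : ℕ} (P : Protocol n m c R) (r : Vec Bool R) where
  open Protocol P

  -- The last input does not influence the transcript, so `𝟎` stands in for it.
  transcriptBy : Vec (𝔽₂^ n) m → Vec (Vec Bool c) m
  transcriptBy y = transcriptOf P r y 𝟎

  run-last : ∀ y z → runProtocol P (y ∷ʳ z) r ≡ out z (transcriptBy y) r
  run-last y z = cong₂ (λ x t → out x t r) (lookup-∷ʳ-last y z)
    (rect-transcript P r (transcriptBy y) y z (transcript-rect P r (transcriptBy y) y 𝟎 refl))

  private
    ts = vecs (vecs bits c) m
    ys = vecs (cube n) m

  -- Each `y` lies in the rectangle of its own transcript and in no other, so the rectangles
  -- partition the inputs.
  ∑-by-transcript : (G : Vec (Vec Bool c) m → Vec (𝔽₂^ n) m → ℕ) →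
    ∑ ts (λ t → ∑ ys (λ y → 𝟙 (inRect (rect P r t) y) * G t y)) ≡ ∑ ys (λ y → G (transcriptBy y) y)
  ∑-by-transcript G = trans (ℕΣ.∑-comm ts ys _) (ℕΣ.∑-cong ys (λ y → trans
    (ℕΣ.∑-cong ts (λ t → cong (λ b → 𝟙 b * G t y) (inRect-rect P r t y 𝟎)))
    (∑-δ-vecs (∑-δ-vecs ∑-δ-bits c) m (transcriptBy y) (λ t → G t y))))

  -- Once `r` and `y` are drawn, the transcript and its heavy functionals are constants. By
  -- computation, evaluating at `x` gives the last player's output on `represent K _ x ⊕ sumVecs y`.
  junta : (K : ℕ) → Vec (𝔽₂^ n) m → LinJunta n K
  junta K y = record
    { ℓs = heavyBasis K (rect P r (transcriptBy y))
    ; h = λ v → out (preimage (heavyBasis K (rect P r (transcriptBy y))) v ⊕ sumVecs y) (transcriptBy y) r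
    }

  length-ts : length ts ≡ 2 ^ (c * m)
  length-ts = trans (length-vecs (vecs bits c) m) (trans (cong (_^ m) (length-cube c)) (ℕₚ.^-*-assoc 2 c m))

  -- Sums `represent-count` over all transcripts. The rectangle sizes add up to `2 ^ (n * m)`, and
  -- there are `2 ^ (c * m)` transcripts, so the small rectangles together cost only one further
  -- `2 ^ (n * m)`.
  junta-simulates : 0 < c → 0 < m → ∀ {K} → 12 + 32 * c ≤ K → ∀ x b →
    2 ^ ⌊ m /2⌋ * ∑ ys (λ y → 𝟙 (runProtocol P (y ∷ʳ (x ⊕ sumVecs y)) r == b)) ≤
    2 ^ ⌊ m /2⌋ * ∑ ys (λ y → 𝟙 (evalJunta (junta K y) x == b)) + 2 ^ (2 + n) * 2 ^ (n * m)
  junta-simulates 0<c 0<m {K} c≤K x b = ℕₚ.*-cancelˡ-≤ w {{ℕₚ.m^n≢0 2 (c * m)}} (begin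
    w * (H * ∑ ys (λ y → 𝟙 (runProtocol P (y ∷ʳ (x ⊕ sumVecs y)) r == b)))
      ≡⟨ cong (λ s → w * (H * s)) (ℕΣ.∑-cong ys (λ y → cong (λ v → 𝟙 (v == b)) (run-last y (x ⊕ sumVecs y)))) ⟩
    w * (H * ∑ ys (λ y → 𝟙 (out (x ⊕ sumVecs y) (transcriptBy y) r == b)))
      ≡⟨ cong (λ s → w * (H * s)) (∑-by-transcript (λ t y → 𝟙 (out (x ⊕ sumVecs y) t r == b))) ⟨
    w * (H * ∑ ts (λ t → before t)) ≡⟨ pull w H before ⟨
    ∑ ts (λ t → w * (H * before t))
      ≤⟨ ∑-mono ts (λ t → represent-count K (rect P r t) c 0<c 0<m c≤K (λ v → out v t r == b) x) ⟩
    ∑ ts (λ t → w * (H * after t + 2 ^ suc n * ∏ size (rect P r t)) + T)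
      ≡⟨ ℕΣ.∑-+ ts _ _ ⟩
    ∑ ts (λ t → w * (H * after t + 2 ^ suc n * ∏ size (rect P r t))) + ∑ ts (λ _ → T)
      ≡⟨ cong₂ _+_ (trans (ℕΣ.∑-*ˡ ts w _) (cong (w *_) (trans (ℕΣ.∑-+ ts _ _)
           (cong₂ _+_ (trans (ℕΣ.∑-*ˡ ts H _) (cong (H *_) (∑-by-transcript (λ t y → 𝟙 (out (represent K (rect P r t) x ⊕ sumVecs y) t r == b)))))
                      (trans (ℕΣ.∑-*ˡ ts (2 ^ suc n) _) (cong (2 ^ suc n *_) ∑rects))))))
         (trans (∑-const ts T) (cong (_* T) length-ts)) ⟩
    w * (H * Z + 2 ^ suc n * T) + w * T ≡⟨ ℕₚ.*-distribˡ-+ w (H * Z + 2 ^ suc n * T) T ⟨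
    -- The loss from small rectangles is bounded by the loss already allowed for light characters,
    -- so the factor `2 ^ suc n` merely doubles.
    w * ((H * Z + 2 ^ suc n * T) + T) ≤⟨ ℕₚ.*-monoʳ-≤ w (ℕₚ.+-monoʳ-≤ (H * Z + 2 ^ suc n * T) T≤) ⟩
    w * ((H * Z + 2 ^ suc n * T) + 2 ^ suc n * T) ≡⟨ cong (w *_) (e (H * Z) (2 ^ suc n) T) ⟩
    w * (H * Z + 2 ^ (2 + n) * T) ∎)
    where
    open ℕₚ.≤-Reasoning
    w = 2 ^ (c * m)
    H = 2 ^ ⌊ m /2⌋
    T = 2 ^ (n * m)
    Z = ∑ ys (λ y → 𝟙 (evalJunta (junta K y) x == b))
    before = λ t → count (rect P r t) (λ v → out v t r == b) x
    after = λ t → count (rect P r t) (λ v → out v t r == b) (represent K (rect P r t) x)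
    pull : ∀ w H (g : Vec (Vec Bool c) m → ℕ) → ∑ ts (λ t → w * (H * g t)) ≡ w * (H * ∑ ts g)
    pull w H g = trans (ℕΣ.∑-*ˡ ts w _) (cong (w *_) (ℕΣ.∑-*ˡ ts H g))
    ∑rects : ∑ ts (λ t → ∏ size (rect P r t)) ≡ T
    ∑rects = trans (ℕΣ.∑-cong ts (λ t → trans (sym (∏size (rect P r t)))
                      (ℕΣ.∑-cong ys (λ y → sym (ℕₚ.*-identityʳ (𝟙 (inRect (rect P r t) y)))))))
             (trans (∑-by-transcript (λ _ _ → 1)) (trans (sym (length≡∑1 ys)) (length-vecs-cube n m)))
    T≤ : T ≤ 2 ^ suc n * T
    T≤ = ℕₚ.≤-trans (ℕₚ.≤-reflexive (sym (ℕₚ.*-identityˡ T))) (ℕₚ.*-monoˡ-≤ T (ℕₚ.m^n>0 2 (suc n)))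
    e : ∀ j s T → (j + s * T) + s * T ≡ j + 2 * s * T
    e = ℕ-Solver.solve-∀

-- Rational estimates

toℚᵘ-/ : ∀ i d → toℚᵘ (i ℚ./ suc d) ℚᵘ.≃ mkℚᵘ i d
toℚᵘ-/ i d = ℚₚ.toℚᵘ-fromℚᵘ (mkℚᵘ i d)

≤/⇒ : ∀ q (a d : ℕ) .{{_ : NonZero d}} → q ≤ℚ (+ a) ℚ./ d → ↥ q ℤ.* + d ℤ.≤ + a ℤ.* ↧ q
≤/⇒ q@(ℚ.mkℚ _ _ _) a (suc d) le = ℚᵘₚ.drop-*≤* (ℚᵘₚ.≤-respʳ-≃ (toℚᵘ-/ (+ a) d) (ℚₚ.toℚᵘ-mono-≤ {q} {(+ a) ℚ./ suc d} le))

^ℚ-* : ∀ p q k → (p ^ℚ k) ℚ.* (q ^ℚ k) ≡ (p ℚ.* q) ^ℚ k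
^ℚ-* p q zero = refl
^ℚ-* p q (suc k) = trans (interchange p (p ^ℚ k) q (q ^ℚ k)) (cong ((p ℚ.* q) ℚ.*_) (^ℚ-* p q k))
  where open import Algebra.Properties.CommutativeSemigroup
          (CommutativeMonoid.commutativeSemigroup ℚₚ.*-1-commutativeMonoid) using (interchange)

*-0≤ : ∀ {p q} → 0ℚ ≤ℚ p → 0ℚ ≤ℚ q → 0ℚ ≤ℚ p ℚ.* q
*-0≤ {p} {q} 0≤p 0≤q =
  subst (_≤ℚ p ℚ.* q) (ℚₚ.*-zeroʳ p) (ℚₚ.*-monoˡ-≤-nonNeg p {{ℚ.nonNegative 0≤p}} 0≤q)

^ℚ-0≤ : ∀ p k → 0ℚ ≤ℚ p → 0ℚ ≤ℚ p ^ℚ k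
^ℚ-0≤ p zero 0≤p = ℚₚ.nonNegative⁻¹ 1ℚ
^ℚ-0≤ p (suc k) 0≤p = *-0≤ 0≤p (^ℚ-0≤ p k 0≤p)

^ℚ-≤1 : ∀ p k → 0ℚ ≤ℚ p → p ≤ℚ 1ℚ → p ^ℚ k ≤ℚ 1ℚ
^ℚ-≤1 p zero 0≤p p≤1 = ℚₚ.≤-refl
^ℚ-≤1 p (suc k) 0≤p p≤1 = ℚₚ.≤-trans
  (subst (p ℚ.* (p ^ℚ k) ≤ℚ_) (ℚₚ.*-identityʳ p)
         (ℚₚ.*-monoˡ-≤-nonNeg p {{ℚ.nonNegative 0≤p}} (^ℚ-≤1 p k 0≤p p≤1)))
  p≤1

ℕ⇒ℚ : ℕ → ℚ
ℕ⇒ℚ a = (+ a) ℚ./ 1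

ℕ⇒ℚ-* : ∀ a b → ℕ⇒ℚ (a * b) ≡ ℕ⇒ℚ a ℚ.* ℕ⇒ℚ b
ℕ⇒ℚ-* a b = ℚₚ.toℚᵘ-injective (begin
  toℚᵘ (ℕ⇒ℚ (a * b)) ≈⟨ toℚᵘ-/ (+ (a * b)) 0 ⟩
  mkℚᵘ (+ (a * b)) 0 ≡⟨ cong (λ i → mkℚᵘ i 0) (ℤₚ.pos-* a b) ⟩
  mkℚᵘ (+ a) 0 ℚᵘ.* mkℚᵘ (+ b) 0 ≈⟨ ℚᵘₚ.*-cong (toℚᵘ-/ (+ a) 0) (toℚᵘ-/ (+ b) 0) ⟨
  toℚᵘ (ℕ⇒ℚ a) ℚᵘ.* toℚᵘ (ℕ⇒ℚ b) ≈⟨ ℚₚ.toℚᵘ-homo-* (ℕ⇒ℚ a) (ℕ⇒ℚ b) ⟨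
  toℚᵘ (ℕ⇒ℚ a ℚ.* ℕ⇒ℚ b) ∎)
  where open ℚᵘₚ.≃-Reasoning

ℕ⇒ℚ-mono : ∀ {a b} → a ≤ b → ℕ⇒ℚ a ≤ℚ ℕ⇒ℚ b
ℕ⇒ℚ-mono {a} {b} le = ℚₚ.toℚᵘ-cancel-≤
  (ℚᵘₚ.≤-respʳ-≃ (ℚᵘₚ.≃-sym (toℚᵘ-/ (+ b) 0)) (ℚᵘₚ.≤-respˡ-≃ (ℚᵘₚ.≃-sym (toℚᵘ-/ (+ a) 0))
    (ℚᵘ.*≤* (ℤₚ.*-monoʳ-≤-nonNeg (+ 1) (ℤ.+≤+ le)))))

0≤ℕ⇒ℚ : ∀ a → 0ℚ ≤ℚ ℕ⇒ℚ a
0≤ℕ⇒ℚ a = ℕ⇒ℚ-mono {0} {a} z≤n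

ℕ⇒ℚ-^ : ∀ a k → ℕ⇒ℚ (a ^ k) ≡ ℕ⇒ℚ a ^ℚ k
ℕ⇒ℚ-^ a zero = refl
ℕ⇒ℚ-^ a (suc k) = trans (ℕ⇒ℚ-* a (a ^ k)) (cong (ℕ⇒ℚ a ℚ.*_) (ℕ⇒ℚ-^ a k))

≤/+1/⇐ : ∀ q (S D E : ℕ) .{{_ : NonZero D}} .{{_ : NonZero E}} →
         ↥ q ℤ.* + (D * E) ℤ.≤ + (S * E + D) ℤ.* ↧ q → q ≤ℚ ((+ S) ℚ./ D) ℚ.+ ((+ 1) ℚ./ E)
≤/+1/⇐ q@(ℚ.mkℚ _ _ _) S (suc d) (suc e) le = ℚₚ.toℚᵘ-cancel-≤ (ℚᵘₚ.≤-respʳ-≃ (ℚᵘₚ.≃-sym sum≃)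
  (ℚᵘ.*≤* (subst₂ ℤ._≤_ (cong (↥ q ℤ.*_) (ℤₚ.pos-* (suc d) (suc e))) (cong (ℤ._* ↧ q) numerator) le)))
  where
  sum≃ : toℚᵘ (((+ S) ℚ./ suc d) ℚ.+ ((+ 1) ℚ./ suc e)) ℚᵘ.≃ mkℚᵘ (+ S) d ℚᵘ.+ mkℚᵘ (+ 1) e
  sum≃ = ℚᵘₚ.≃-trans (ℚₚ.toℚᵘ-homo-+ ((+ S) ℚ./ suc d) ((+ 1) ℚ./ suc e))
                     (ℚᵘₚ.+-cong (toℚᵘ-/ (+ S) d) (toℚᵘ-/ (+ 1) e))
  numerator : + (S * suc e + suc d) ≡ + S ℤ.* + suc e ℤ.+ + 1 ℤ.* + suc d
  numerator = trans (ℤₚ.pos-+ (S * suc e) (suc d))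
    (cong₂ ℤ._+_ (ℤₚ.pos-* S (suc e)) (sym (ℤₚ.*-identityˡ (+ suc d))))

1/E*E : ∀ E .{{_ : NonZero E}} → ((+ 1) ℚ./ E) ℚ.* ℕ⇒ℚ E ≡ 1ℚ
1/E*E (suc e) = ℚₚ.toℚᵘ-injective (begin
  toℚᵘ (((+ 1) ℚ./ suc e) ℚ.* ℕ⇒ℚ (suc e)) ≈⟨ ℚₚ.toℚᵘ-homo-* ((+ 1) ℚ./ suc e) (ℕ⇒ℚ (suc e)) ⟩
  toℚᵘ ((+ 1) ℚ./ suc e) ℚᵘ.* toℚᵘ (ℕ⇒ℚ (suc e))
    ≈⟨ ℚᵘₚ.*-cong (toℚᵘ-/ (+ 1) e) (toℚᵘ-/ (+ suc e) 0) ⟩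
  mkℚᵘ (+ 1) e ℚᵘ.* mkℚᵘ (+ suc e) 0 ≈⟨ ℚᵘ.*≡* (swap (+ suc e)) ⟩
  toℚᵘ 1ℚ ∎)
  where
  open ℚᵘₚ.≃-Reasoning
  swap : ∀ i → ((+ 1) ℤ.* i) ℤ.* + 1 ≡ + 1 ℤ.* (i ℤ.* + 1)
  swap = ℤ-Solver.solve-∀

-- If `δ = q - p` lies between 0 and `2 ^ -e`, then `δ ^ d * 2 ^ N` is at most `(δ * 2 ^ e) ^ d`, a
-- power of a number in the unit interval.
atLeastMinusExp : ∀ p q d N e → q ≤ℚ p ℚ.+ ℚ._/_ (+ 1) (2 ^ e) {{ℕₚ.m^n≢0 2 e}} → N ≤ e * d →
                  AtLeastMinusExp p q d N
atLeastMinusExp p q d N e le N≤ed with ℚₚ.≤-total q p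
... | inj₁ q≤p = inj₁ q≤p
... | inj₂ p≤q = inj₂ (begin
  (δ ^ℚ d) ℚ.* ℕ⇒ℚ (2 ^ N)
    ≤⟨ ℚₚ.*-monoˡ-≤-nonNeg (δ ^ℚ d) {{ℚ.nonNegative (^ℚ-0≤ δ d 0≤δ)}} (ℕ⇒ℚ-mono (ℕₚ.^-monoʳ-≤ 2 N≤ed)) ⟩
  (δ ^ℚ d) ℚ.* ℕ⇒ℚ (2 ^ (e * d)) ≡⟨ cong (λ k → (δ ^ℚ d) ℚ.* ℕ⇒ℚ k) (ℕₚ.^-*-assoc 2 e d) ⟨
  (δ ^ℚ d) ℚ.* ℕ⇒ℚ ((2 ^ e) ^ d) ≡⟨ cong ((δ ^ℚ d) ℚ.*_) (ℕ⇒ℚ-^ (2 ^ e) d) ⟩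
  (δ ^ℚ d) ℚ.* (W ^ℚ d) ≡⟨ ^ℚ-* δ W d ⟩
  (δ ℚ.* W) ^ℚ d ≤⟨ ^ℚ-≤1 (δ ℚ.* W) d (*-0≤ 0≤δ (0≤ℕ⇒ℚ (2 ^ e))) δW≤1 ⟩
  1ℚ ∎)
  where
  open ℚₚ.≤-Reasoning
  instance _ = ℕₚ.m^n≢0 2 e
  δ = q ℚ.- p
  W = ℕ⇒ℚ (2 ^ e)
  ε = (+ 1) ℚ./ (2 ^ e)
  0≤δ : 0ℚ ≤ℚ δ
  0≤δ = subst (_≤ℚ δ) (ℚₚ.+-inverseʳ p) (ℚₚ.+-monoˡ-≤ (ℚ.- p) p≤q)
  δ≤ε : δ ≤ℚ ε
  δ≤ε = subst (δ ≤ℚ_) cancel (ℚₚ.+-monoˡ-≤ (ℚ.- p) le)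
    where
    cancel : (p ℚ.+ ε) ℚ.- p ≡ ε
    cancel = trans (cong (ℚ._- p) (ℚₚ.+-comm p ε)) (trans (ℚₚ.+-assoc ε p (ℚ.- p))
      (trans (cong (ε ℚ.+_) (ℚₚ.+-inverseʳ p)) (ℚₚ.+-identityʳ ε)))
  δW≤1 : δ ℚ.* W ≤ℚ 1ℚ
  δW≤1 = subst (δ ℚ.* W ≤ℚ_) (1/E*E (2 ^ e))
    (ℚₚ.*-monoʳ-≤-nonNeg W {{ℚ.nonNegative (0≤ℕ⇒ℚ (2 ^ e))}} δ≤ε)

-- Averaging over inputs and the error exponent

countB≡∑ : ∀ {A : Set} (p : A → Bool) xs → countB p xs ≡ ∑ xs (λ x → 𝟙 (p x))
countB≡∑ p [] = refl
countB≡∑ p (x ∷ xs) with p x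
... | true = cong suc (countB≡∑ p xs)
... | false = countB≡∑ p xs

length-allVecs : ∀ R → length (allVecs R) ≡ 2 ^ R
length-allVecs zero = refl
length-allVecs (suc R) = trans (doubles (allVecs R)) (cong (2 *_) (length-allVecs R))
  where
  doubles : ∀ vs → length (concatMap (λ v → (false ∷ v) ∷ (true ∷ v) ∷ []) vs) ≡ 2 * length {A = Vec Bool R} vs
  doubles [] = refl
  doubles (v ∷ vs) = trans (cong (λ k → suc (suc k)) (doubles vs)) (sym (ℕₚ.*-suc 2 (length vs)))

-- Averaging with cleared denominators; applied with `i = ↥ q * 2 ^ R` and `v = ↧ q`.
∑-≥ : ∀ {A : Set} (xs : List A) (i : ℤ) (v : ℤ) (g : A → ℕ) → (∀ x → i ℤ.≤ + g x ℤ.* v) →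
      i ℤ.* + length xs ℤ.≤ + ∑ xs g ℤ.* v
∑-≥ [] i v g le = ℤₚ.≤-reflexive (trans (ℤₚ.*-zeroʳ i) (sym (ℤₚ.*-zeroˡ v)))
∑-≥ (x ∷ xs) i v g le = subst₂ ℤ._≤_
  (sym (ℤₚ.*-suc i (+ length xs)))
  (sym (trans (cong (ℤ._* v) (ℤₚ.pos-+ (g x) (∑ xs g))) (ℤₚ.*-distribʳ-+ v (+ g x) (+ ∑ xs g))))
  (ℤₚ.+-mono-≤ (le x) (∑-≥ xs i v g le))

-- In characteristic 2 the two copies of `sumVecs y` cancel. So giving `x ⊕ sumVecs y` to the last
-- player completes `y` to an honest run on inputs summing to `x`.
sumVecs-∷ʳ : ∀ {n m} (y : Vec (𝔽₂^ n) m) x → sumVecs (y ∷ʳ (x ⊕ sumVecs y)) ≡ x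
sumVecs-∷ʳ y x = trans (snoc y (x ⊕ sumVecs y)) (cancel x (sumVecs y))
  where
  ⊕-assoc : ∀ {n} (a b c : 𝔽₂^ n) → (a ⊕ b) ⊕ c ≡ a ⊕ (b ⊕ c)
  ⊕-assoc = Vecₚ.zipWith-assoc Boolₚ.xor-assoc
  snoc : ∀ {n m} (y : Vec (𝔽₂^ n) m) z → sumVecs (y ∷ʳ z) ≡ sumVecs y ⊕ z
  snoc [] z = Vecₚ.zipWith-comm Boolₚ.xor-comm z 𝟎
  snoc (x ∷ y) z = trans (cong (x ⊕_) (snoc y z)) (sym (⊕-assoc x (sumVecs y) z))
  cancel : ∀ {n} (x s : 𝔽₂^ n) → s ⊕ (x ⊕ s) ≡ x
  cancel [] [] = refl
  cancel (a ∷ x) (b ∷ s) = cong₂ _∷_ (xor-cancel a b) (cancel x s)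
    where
    xor-cancel : ∀ a b → b xor (a xor b) ≡ a
    xor-cancel false false = refl
    xor-cancel false true = refl
    xor-cancel true false = refl
    xor-cancel true true = refl

-- `e` is what remains of the exponent `h = ⌊ m /2⌋` after paying for the factor `2 ^ (2 + n)`. With
-- `N = suc m`, both `10n ≤ N` and `10 ≤ N` enter `10n + 30 + N ≤ 5N ≤ 10h + 10`, which is an
-- equality for `n = 1` and `N = 10`.
error-exponent : ∀ n m → 0 < n → 10 * n ≤ suc m → ∃ λ e → 2 + n + e ≡ ⌊ m /2⌋ × suc m ≤ e * 10
error-exponent n m 0<n 10n≤N =
  let e , eq = ℕₚ.m≤n⇒∃[o]m+o≡n {2 + n} (ℕₚ.*-cancelˡ-≤ 10 (ℕₚ.≤-trans (ℕₚ.m≤m+n (10 * (2 + n)) (suc m)) main))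
  in e , eq , subst (suc m ≤_) (ℕₚ.*-comm 10 e) (ℕₚ.+-cancelˡ-≤ (10 * (2 + n)) _ _
       (subst (10 * (2 + n) + suc m ≤_) (trans (cong (10 *_) (sym eq)) (ℕₚ.*-distribˡ-+ 10 (2 + n) e)) main))
  where
  h = ⌊ m /2⌋
  open ℕₚ.≤-Reasoning
  N≤2h+2 : suc m ≤ 2 * h + 2
  N≤2h+2 = begin
    suc m ≡⟨ cong suc (ℕₚ.⌊n/2⌋+⌈n/2⌉≡n m) ⟨
    suc (h + ⌊ suc m /2⌋) ≤⟨ s≤s (ℕₚ.+-monoʳ-≤ h (⌊1+n/2⌋≤ m)) ⟩
    suc (h + suc h) ≡⟨ e₁ h ⟩
    2 * h + 2 ∎
    where
    ⌊1+n/2⌋≤ : ∀ k → ⌊ suc k /2⌋ ≤ suc ⌊ k /2⌋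
    ⌊1+n/2⌋≤ zero = z≤n
    ⌊1+n/2⌋≤ (suc zero) = s≤s z≤n
    ⌊1+n/2⌋≤ (suc (suc k)) = s≤s (⌊1+n/2⌋≤ k)
    e₁ : ∀ h → suc (h + suc h) ≡ 2 * h + 2
    e₁ = ℕ-Solver.solve-∀
  main : 10 * (2 + n) + suc m ≤ 10 * h
  main = ℕₚ.+-cancelʳ-≤ 10 _ _ (begin
    10 * (2 + n) + suc m + 10 ≡⟨ e₁ n (suc m) ⟩
    3 * (10 * 1) + 10 * n + suc m
      ≤⟨ ℕₚ.+-monoˡ-≤ (suc m) (ℕₚ.+-mono-≤ (ℕₚ.*-monoʳ-≤ 3 (ℕₚ.≤-trans (ℕₚ.*-monoʳ-≤ 10 0<n) 10n≤N)) 10n≤N) ⟩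
    3 * suc m + suc m + suc m ≡⟨ e₂ (suc m) ⟩
    5 * suc m ≤⟨ ℕₚ.*-monoʳ-≤ 5 N≤2h+2 ⟩
    5 * (2 * h + 2) ≡⟨ e₃ h ⟩
    10 * h + 10 ∎)
    where
    e₁ : ∀ n N → 10 * (2 + n) + N + 10 ≡ 3 * (10 * 1) + 10 * n + N
    e₁ = ℕ-Solver.solve-∀
    e₂ : ∀ N → 3 * N + N + N ≡ 5 * N
    e₂ = ℕ-Solver.solve-∀
    e₃ : ∀ h → 5 * (2 * h + 2) ≡ 10 * h + 10
    e₃ = ℕ-Solver.solve-∀

-- The sketch

module _ {n m c R : ℕ} (P : Protocol n m c R) (K : ℕ) where

  private
    ys = vecs (cube n) m

  juntas : List (LinJunta n K)
  juntas = cartesianProductWith (λ r y → junta P r K y) (allVecs R) ys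

  length-juntas : length juntas ≡ 2 ^ R * 2 ^ (n * m)
  length-juntas = trans (length≡∑1 juntas)
    (trans (ℕΣ.∑-cartesian _ (allVecs R) ys (λ _ → 1))
    (trans (∑-const (allVecs R) _) (cong₂ _*_ (length-allVecs R)
      (trans (sym (length≡∑1 ys)) (length-vecs-cube n m)))))

  juntas-nonempty : 0 < length juntas
  juntas-nonempty = subst (0 <_) (sym length-juntas) (ℕₚ.*-mono-≤ (ℕₚ.m^n>0 2 R) (ℕₚ.m^n>0 2 (n * m)))

  sketch : LinSketch n K
  sketch = record { support = juntas ; nonempty = juntas-nonempty }

  module _ (f : 𝔽₂^ n → Bool) (x : 𝔽₂^ n) where

    input : Vec (𝔽₂^ n) m → Vec (𝔽₂^ n) (suc m)
    input y = y ∷ʳ (x ⊕ sumVecs y)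

    runs : Vec (𝔽₂^ n) m → ℕ
    runs y = countB (λ r → runProtocol P (input y) r == f (sumVecs (input y))) (allVecs R)

    successes : ℕ
    successes = countB (λ g → evalJunta g x == f x) juntas

    -- This is `junta-simulates` with `b = f x`, summed over `r`. By `sumVecs-∷ʳ` all runs counted
    -- here are on inputs with sum `x`, so their target value is `f x`.
    simulation : 0 < c → 0 < m → 12 + 32 * c ≤ K →
      2 ^ ⌊ m /2⌋ * ∑ ys runs ≤ 2 ^ ⌊ m /2⌋ * successes + 2 ^ (2 + n) * length juntas
    simulation 0<c 0<m c≤K = begin
      H * ∑ ys runs
        ≡⟨ cong (H *_) (trans (ℕΣ.∑-cong ys (λ y → trans (countB≡∑ _ (allVecs R))
             (ℕΣ.∑-cong (allVecs R) (λ r → cong (λ s → 𝟙 (runProtocol P (input y) r == f s)) (sumVecs-∷ʳ y x)))))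
             (ℕΣ.∑-comm ys (allVecs R) _)) ⟩
      H * ∑ (allVecs R) run ≡⟨ ℕΣ.∑-*ˡ (allVecs R) H run ⟨
      ∑ (allVecs R) (λ r → H * run r)
        ≤⟨ ∑-mono (allVecs R) (λ r → junta-simulates P r 0<c 0<m c≤K x (f x)) ⟩
      ∑ (allVecs R) (λ r → H * hit r + 2 ^ (2 + n) * T) ≡⟨ ℕΣ.∑-+ (allVecs R) _ _ ⟩
      ∑ (allVecs R) (λ r → H * hit r) + ∑ (allVecs R) (λ _ → 2 ^ (2 + n) * T)
        ≡⟨ cong₂ _+_ (trans (ℕΣ.∑-*ˡ (allVecs R) H hit) (cong (H *_) (sym hits)))
                     (trans (∑-const (allVecs R) _) (cong (_* (2 ^ (2 + n) * T)) (length-allVecs R))) ⟩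
      H * successes + 2 ^ R * (2 ^ (2 + n) * T)
        ≡⟨ cong (_+_ (H * successes)) (trans (*-exchange (2 ^ R) (2 ^ (2 + n)) T) (cong (2 ^ (2 + n) *_) (sym length-juntas))) ⟩
      H * successes + 2 ^ (2 + n) * length juntas ∎
      where
      open ℕₚ.≤-Reasoning
      H = 2 ^ ⌊ m /2⌋
      T = 2 ^ (n * m)
      run = λ r → ∑ ys (λ y → 𝟙 (runProtocol P (input y) r == f x))
      hit = λ r → ∑ ys (λ y → 𝟙 (evalJunta (junta P r K y) x == f x))
      hits : successes ≡ ∑ (allVecs R) hit
      hits = trans (countB≡∑ _ juntas) (ℕΣ.∑-cartesian _ (allVecs R) ys _)

    sketch-succeeds : ∀ q → 0 < n → 0 < c → 0 < m → 12 + 32 * c ≤ K → 10 * n ≤ suc m →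
      (∀ xs → q ≤ℚ protocolSuccessProb P (λ ys → f (sumVecs ys)) xs) →
      AtLeastMinusExp (sketchSuccessProb sketch f x) q 10 (suc m)
    sketch-succeeds q 0<n 0<c 0<m c≤K 10n≤N succeeds = atLeastMinusExp (sketchSuccessProb sketch f x) q 10 (suc m) e
      (≤/+1/⇐ q successes D E {{>-nonZero juntas-nonempty}} {{ℕₚ.m^n≢0 2 e}} (begin
        ↥ q ℤ.* + (D * E) ≡⟨ cong (↥ q ℤ.*_) (trans (ℤₚ.pos-* D E) (cong (ℤ._* + E)
             (trans (cong +_ (trans length-juntas (cong (2 ^ R *_) (sym (length-vecs-cube n m))))) (ℤₚ.pos-* (2 ^ R) (length ys))))) ⟩
        ↥ q ℤ.* (+ (2 ^ R) ℤ.* + length ys ℤ.* + E) ≡⟨ e₁ (↥ q) (+ (2 ^ R)) (+ length ys) (+ E) ⟩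
        (↥ q ℤ.* + (2 ^ R)) ℤ.* + length ys ℤ.* + E
          -- Success probability `q` holds on every single input, hence also on average over `y`.
          ≤⟨ ℤₚ.*-monoʳ-≤-nonNeg (+ E) (∑-≥ ys (↥ q ℤ.* + (2 ^ R)) (↧ q) runs (λ y →
               ≤/⇒ q (runs y) (2 ^ R) {{ℕₚ.m^n≢0 2 R}} (succeeds (input y)))) ⟩
        + ∑ ys runs ℤ.* ↧ q ℤ.* + E ≡⟨ e₂ (+ ∑ ys runs) (↧ q) (+ E) ⟩
        + ∑ ys runs ℤ.* + E ℤ.* ↧ q ≡⟨ cong (ℤ._* ↧ q) (ℤₚ.pos-* (∑ ys runs) E) ⟨
        + (∑ ys runs * E) ℤ.* ↧ q ≤⟨ ℤₚ.*-monoʳ-≤-nonNeg (↧ q) (ℤ.+≤+ scaled) ⟩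
        + (successes * E + D) ℤ.* ↧ q ∎)) N≤10e
      where
      open ℤₚ.≤-Reasoning
      D = length juntas
      exponent = error-exponent n m 0<n 10n≤N
      e = proj₁ exponent
      eq = proj₁ (proj₂ exponent)
      N≤10e = proj₂ (proj₂ exponent)
      E = 2 ^ e
      e₁ : ∀ u r l w → u ℤ.* (r ℤ.* l ℤ.* w) ≡ (u ℤ.* r) ℤ.* l ℤ.* w
      e₁ = ℤ-Solver.solve-∀
      e₂ : ∀ b v w → b ℤ.* v ℤ.* w ≡ b ℤ.* w ℤ.* v
      e₂ = ℤ-Solver.solve-∀
      -- Dividing `simulation` by `2 ^ (2 + n)` leaves the error `D` against the scale `E`, that is,
      -- a loss of `2 ^ -e` in probability.
      split : 2 ^ ⌊ m /2⌋ ≡ 2 ^ (2 + n) * E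
      split = trans (cong (2 ^_) (sym eq)) (ℕₚ.^-distribˡ-+-* 2 (2 + n) e)
      e₃ : ∀ w E B → w * (B * E) ≡ w * E * B
      e₃ = ℕ-Solver.solve-∀
      e₄ : ∀ w E S D → w * E * S + w * D ≡ w * (S * E + D)
      e₄ = ℕ-Solver.solve-∀
      scaled : ∑ ys runs * E ≤ successes * E + D
      scaled = ℕₚ.*-cancelˡ-≤ (2 ^ (2 + n)) {{ℕₚ.m^n≢0 2 (2 + n)}}
        (subst₂ _≤_ (sym (e₃ (2 ^ (2 + n)) E (∑ ys runs))) (e₄ (2 ^ (2 + n)) E successes D)
          (subst (λ H → H * ∑ ys runs ≤ H * successes + 2 ^ (2 + n) * D) split (simulation 0<c 0<m c≤K)))

theorem2p1 : Σ ℕ λ C → 0 < C × Σ ℕ λ d → 0 < d ×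
    ((n m c : ℕ) → 0 < n → 0 < c → 10 * n ≤ suc m →
    (f : 𝔽₂^ n → Bool) → (R : ℕ) → (P : Protocol n m c R) → (q : ℚ) →
    ((xs : Vec (𝔽₂^ n) (suc m)) →
    q ≤ℚ protocolSuccessProb P (λ ys → f (sumVecs ys)) xs) →
    Σ ℕ λ k → k ≤ C * c × Σ (LinSketch n k) λ S →
    ((x : 𝔽₂^ n) → AtLeastMinusExp (sketchSuccessProb S f x) q d (suc m)))
-- `44` is `12 + 32`, the additive 12 being absorbed because `c ≥ 1`; `d = 10` means `α = 1/10`.
theorem2p1 = 44 , s≤s z≤n , 10 , s≤s z≤n , λ n m c 0<n 0<c 10n≤N f R P q succeeds →
  44 * c , ℕₚ.≤-refl , sketch P (44 * c) , λ x →
  sketch-succeeds P (44 * c) f x q 0<n 0<c (0<m 0<n 10n≤N) (cost 0<c) 10n≤N succeeds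
  where
  0<m : ∀ {n m} → 0 < n → 10 * n ≤ suc m → 0 < m
  0<m 0<n 10n≤N = ℕₚ.≤-pred (ℕₚ.≤-trans (s≤s (s≤s z≤n)) (ℕₚ.≤-trans (ℕₚ.*-monoʳ-≤ 10 0<n) 10n≤N))
  cost : ∀ {c} → 0 < c → 12 + 32 * c ≤ 44 * c
  cost {c} 0<c = ℕₚ.≤-trans (ℕₚ.+-monoˡ-≤ (32 * c) (ℕₚ.*-monoʳ-≤ 12 0<c)) (ℕₚ.≤-reflexive (sym (ℕₚ.*-distribʳ-+ c 12 32)))
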